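{- Let $\mathbf{z}$ be the ternary sequence defined as follows. Define morphisms $f,g:\{0,1,2\}^*\to\{0,1,2\}^*$ by $f(0)=01,\ f(1)=022,\ f(2)=02$ and $g(0)=20,\ g(1)=21,\ g(2)=2$; let $\mathbf{y}=g(f^\omega(0))=y_0y_1y_2\cdots$; let $A=00101101$, $B=001$, $C=00202202$, $D=002$; and let $\mathbf{z}=\tau(y_0)\tau(y_1)\cdots$, where $\tau(y_{2i})$ equals $B,A,AA$ according as $y_{2i}=0,1,2$, and $\tau(y_{2i+1})$ equals $D,C,CC$ according as $y_{2i+1}=0,1,2$. Let $R$ be the reversal antimorphism of $\{0,1,2\}^*$ and $S$ the antimorphism with $S(0)=0$, $S(1)=2$, $S(2)=1$, and let $G=\{I,R,S,RS\}$. Then $\mathbf{z}$ is $G$-rich.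
   Context: $f^\omega(0)$ is the infinite sequence having $f^n(0)$ as a prefix for every $n$. An antimorphism $\Theta$ satisfies $\Theta(uv)=\Theta(v)\Theta(u)$; $R$ fixes every letter, so $R(w_0\cdots w_{n-1})=w_{n-1}\cdots w_0$; $I$ is the identity. A word $w$ is a $\Theta$-palindrome if $\Theta(w)=w$. A factor $w$ of a sequence $\mathbf{u}$ is left (right) special if $aw,bw$ (resp. $wa,wb$) are factors for two distinct letters $a,b$. For a group $G$ of morphisms and antimorphisms under which the language (set of factors) of $\mathbf{u}$ is closed, write $[w]=\{\eta(w):\eta\in G\}$. The graph of symmetries $\Gamma_n(\mathbf{u})$ (for $n\in\mathbb N$) is the undirected multigraph whose vertices are the classes $[w]$ with $w$ a factor of length $n$ that is left or right special; two vertices $[w],[v]$ are joined by an edge $[e]$ (a class of factors) if there is a factor $u\in[e]$ of length $>n$ whose prefix of length $n$ lies in $[w]$, whose suffix of length $n$ lies in $[v]$, and which contains no other special factor of length $n$ besides this prefix and suffix. The sequence $\mathbf{u}$ (with language closed under $G$) is $G$-rich if for every $n\ge 1$: (i) $\Gamma_n(\mathbf{u})$ with loops removed is a tree, and (ii) whenever an edge $[e]$ is a loop of $\Gamma_n(\mathbf{u})$, $e$ is a $\Theta$-palindrome for some antimorphism $\Theta\in G$. -}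

module Defs where

open import Data.Nat using (ℕ; zero; suc; _+_; _∸_; _<_; _≤_)
open import Data.Bool using (Bool; true; false; not)
open import Data.List using (List; []; _∷_; _++_; length; take; drop; reverse; map; concatMap; [_])
open import Data.List.Relation.Unary.AllPairs using (AllPairs)
open import Data.Product using (Σ; ∃; ∃-syntax; ∃₂; _×_; _,_)
open import Data.Sum using (_⊎_)
open import Relation.Nullary using (¬_)
open import Relation.Binary.PropositionalEquality using (_≡_; _≢_)

data Letter : Set where
  c0 c1 c2 : Letter

Word : Set
Word = List Letter

Seq : Set
Seq = ℕ → Letter

pre : Seq → ℕ → Word
pre u zero    = []
pre u (suc n) = u 0 ∷ pre (λ k → u (suc k)) n

IsPrefixOf : Word → Seq → Set
IsPrefixOf w u = pre u (length w) ≡ w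

factorAt : Seq → ℕ → ℕ → Word
factorAt u i n = pre (λ k → u (i + k)) n

Factor : Seq → Word → Set
Factor u w = ∃[ i ] factorAt u i (length w) ≡ w

morph : (Letter → Word) → Word → Word
morph h = concatMap h

iter : ℕ → (Word → Word) → Word → Word
iter zero    h w = w
iter (suc n) h w = h (iter n h w)

fL : Letter → Word
fL c0 = c0 ∷ c1 ∷ []
fL c1 = c0 ∷ c2 ∷ c2 ∷ []
fL c2 = c0 ∷ c2 ∷ []

fW : Word → Word
fW = morph fL

gL : Letter → Word
gL c0 = c2 ∷ c0 ∷ []
gL c1 = c2 ∷ c1 ∷ []
gL c2 = c2 ∷ []

wA wB wC wD : Word
wA = c0 ∷ c0 ∷ c1 ∷ c0 ∷ c1 ∷ c1 ∷ c0 ∷ c1 ∷ []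
wB = c0 ∷ c0 ∷ c1 ∷ []
wC = c0 ∷ c0 ∷ c2 ∷ c0 ∷ c2 ∷ c2 ∷ c0 ∷ c2 ∷ []
wD = c0 ∷ c0 ∷ c2 ∷ []

isEven : ℕ → Bool
isEven zero    = true
isEven (suc n) = not (isEven n)

-- τ at an even position (true) / odd position (false)
tauL : Bool → Letter → Word
tauL true  c0 = wB
tauL true  c1 = wA
tauL true  c2 = wA ++ wA
tauL false c0 = wD
tauL false c1 = wC
tauL false c2 = wC ++ wC

-- tauW k w : image of a word w whose first letter sits at position k
tauW : ℕ → Word → Word
tauW k []      = []
tauW k (a ∷ w) = tauL (isEven k) a ++ tauW (suc k) w

data Sym : Set where
  I R S RS : Sym

swapL : Letter → Letter
swapL c0 = c0
swapL c1 = c2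
swapL c2 = c1

act : Sym → Word → Word
act I  w = w
act R  w = reverse w
act S  w = reverse (map swapL w)
act RS w = map swapL w

data IsAnti : Sym → Set where
  anti-R : IsAnti R
  anti-S : IsAnti S

-- G-richness, for a general finite group of (anti)morphisms given by
-- its elements Sy, their action on words, and which are antimorphisms.

module Rich (Sy : Set) (actG : Sy → Word → Word) (Anti : Sy → Set) where

  _~_ : Word → Word → Set
  v ~ w = ∃[ η ] actG η v ≡ w

  Closed : Seq → Set
  Closed u = ∀ η w → Factor u w → Factor u (actG η w)

  LeftSpecial : Seq → Word → Set
  LeftSpecial u w = ∃₂ λ a b → a ≢ b × Factor u (a ∷ w) × Factor u (b ∷ w)

  RightSpecial : Seq → Word → Set
  RightSpecial u w = ∃₂ λ a b → a ≢ b × Factor u (w ++ [ a ]) × Factor u (w ++ [ b ])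

  Special : Seq → Word → Set
  Special u w = LeftSpecial u w ⊎ RightSpecial u w

  suffixN : ℕ → Word → Word
  suffixN n e = drop (length e ∸ n) e

  -- e represents an edge of Γ_n(u): factor longer than n, special prefix
  -- and suffix of length n, no special factor of length n occurring at
  -- any other position.
  IsEdge : Seq → ℕ → Word → Set
  IsEdge u n e =
    Factor u e × n < length e × Special u (take n e) × Special u (suffixN n e) ×
    (∀ i → 0 < i → i < length e ∸ n → ¬ Special u (take n (drop i e)))

  Loop : ℕ → Word → Set
  Loop n e = take n e ~ suffixN n e

  -- walks in Γ_n(u) with loops removed, from vertex [v] to vertex [w],
  -- along the listed edge representatives
  data Walk (u : Seq) (n : ℕ) : Word → Word → List Word → Set where
    nil : ∀ {v w} → v ~ w → Walk u n v w []
    fwd : ∀ {v w e es} → IsEdge u n e → ¬ Loop n e →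
          v ~ take n e → Walk u n (suffixN n e) w es → Walk u n v w (e ∷ es)
    bwd : ∀ {v w e es} → IsEdge u n e → ¬ Loop n e →
          v ~ suffixN n e → Walk u n (take n e) w es → Walk u n v w (e ∷ es)

  Connected : Seq → ℕ → Set
  Connected u n = ∀ v w → length v ≡ n → length w ≡ n →
    Special u v → Special u w → ∃[ es ] Walk u n v w es

  Acyclic : Seq → ℕ → Set
  Acyclic u n = ∀ v es → Walk u n v v es → AllPairs (λ e e′ → ¬ e ~ e′) es → es ≡ []

  IsTree : Seq → ℕ → Set
  IsTree u n = Connected u n × Acyclic u n

  LoopsPal : Seq → ℕ → Set
  LoopsPal u n = ∀ e → IsEdge u n e → Loop n e → ∃[ Θ ] (Anti Θ × actG Θ e ≡ e)

  GRich : Seq → Set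
  GRich u = Closed u × (∀ n → 1 ≤ n → IsTree u n × LoopsPal u n)

open Rich Sym act IsAnti public

{-# OPTIONS --safe #-}

-- Write x = f^ω(0) and let T be the map a ↦ τ(g(a)), so that z = T(x) with blocks whose sign
-- (1 and 2 exchanged or not) is the parity of the number of letters 2 read before.  Both f and T
-- put a palindromic marker in front of every block, so markers locate the block boundaries and
-- palindromes are carried to G-palindromes.  By induction on its length every prefix of x, hence
-- every prefix of z, has a palindromic suffix whose class does not occur earlier: it is the image
-- of such a suffix of the preimage, widened by the part of the next block already read.  The only
-- subtlety is that a short part of a block does not determine the letter, so palindromes
-- enclosed by two letters of {1,2} have to be followed as well.
--
-- Consequently every word joining consecutive occurrences of a class [w] in z is fixed by R or S.
-- This gives the loop condition.  It also shows that between two visits of a vertex of Γₙ each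
-- edge that is no loop is crossed an even number of times, so every such edge is a bridge.  The
-- sequence z walks along Γₙ, which is therefore connected; the splitting of that walk into edges
-- is constructive because z is recurrent with computable bounds.

module Submission where

open import Defs
open import Data.Bool using (Bool; true; false; not; _∧_; _xor_; if_then_else_)
import Data.Bool as Bool
open import Data.Bool.Properties using (not-involutive; not-¬; xor-assoc; xor-comm; xor-same)
open import Data.Nat using (ℕ; zero; suc; _+_; _*_; _∸_; _<_; _≤_; z≤n; s≤s; _≟_; _≤?_; ⌈_/2⌉)
open import Data.Nat.Properties hiding (_≟_; _≤?_)
open import Data.Nat.Induction using (<-rec)
open import Data.Nat.Tactic.RingSolver using (solve-∀)
open import Data.List using ([]; _∷_; _++_; _∷ʳ_; _ʳ++_; length; take; drop; reverse; map; initLast; _∷ʳ′_)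
open import Data.List.Properties
open import Data.List.Relation.Unary.All using (All; []; _∷_)
open import Data.List.Relation.Unary.AllPairs using ([]; _∷_)
open import Data.Product using (∃; ∃-syntax; ∃₂; _×_; _,_; proj₁; proj₂)
open import Data.Sum using (_⊎_; inj₁; inj₂; [_,_]′)
open import Data.Empty using (⊥; ⊥-elim)
open import Function using (_∘_; id; mk⇔)
open import Relation.Binary.Definitions using (tri<; tri≈; tri>)
open import Relation.Binary.PropositionalEquality
open import Relation.Nullary using (¬_; Dec; yes; no; does)
open import Relation.Nullary.Decidable using
  (⌊_⌋; map′; _×-dec_; _⊎-dec_; _→-dec_; ¬?; from-yes; True; toWitness; dec-true; dec-false; does-⇔)

-- The two antimorphisms enter through parity. Since |g(a)| is odd only for a = 2, the image in z of
-- a letter of x starts with AA or CC according to the parity of the letters 2 read before it. The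
-- image of a palindrome s of x is then fixed by R if s has an even number of letters 2 and by S if
-- it has an odd number. The morphism f preserves this parity, which is what makes closure under G
-- and recurrence with signs provable by applying f repeatedly.
--
-- The obstacle lies in f(1) = 022 and f(2) = 02. A prefix of x that stops after their common part
-- 02 is reflected about a palindrome of the preimage whose two neighbours lie in {1,2} but may
-- differ. Such a configuration is not a palindromic suffix of a prefix, so its existence is a
-- separate claim of the induction. The claim sustains itself because two adjacent letters of x
-- include a 0 unless they form the 22 inside f(1).
--
-- The map f, with image x itself, and the map T, with image z, are two instances of one notion of
-- block code, so lifting is proved once for both.

-- Words at a position of a sequence

_≟L_ : (a b : Letter) → Dec (a ≡ b)
c0 ≟L c0 = yes refl
c0 ≟L c1 = no λ ()
c0 ≟L c2 = no λ ()
c1 ≟L c0 = no λ ()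
c1 ≟L c1 = yes refl
c1 ≟L c2 = no λ ()
c2 ≟L c0 = no λ ()
c2 ≟L c1 = no λ ()
c2 ≟L c2 = yes refl

data At (u : Seq) : ℕ → Word → Set where
  []  : ∀ {q} → At u q []
  _∷_ : ∀ {q a w} → u q ≡ a → At u (suc q) w → At u q (a ∷ w)

-- w read backwards from position e (exclusive): u (e-1), u (e-2), ...
data AtB (u : Seq) : ℕ → Word → Set where
  []  : ∀ {e} → AtB u e []
  _∷_ : ∀ {e a w} → u e ≡ a → AtB u e w → AtB u (suc e) (a ∷ w)

sub : Seq → ℕ → ℕ → Word
sub u i zero    = []
sub u i (suc n) = u i ∷ sub u (suc i) n

module _ {u : Seq} where

  At-cast : ∀ {p q w} → p ≡ q → At u p w → At u q w
  At-cast refl h = h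

  AtB-cast : ∀ {p q w} → p ≡ q → AtB u p w → AtB u q w
  AtB-cast refl h = h

  At-++⁺ : ∀ {q v w} → At u q v → At u (q + length v) w → At u q (v ++ w)
  At-++⁺ {q} [] h = At-cast (+-identityʳ q) h
  At-++⁺ {q} (e ∷ g) h = e ∷ At-++⁺ g (At-cast (+-suc q _) h)

  At-++⁻ˡ : ∀ {q} v {w} → At u q (v ++ w) → At u q v
  At-++⁻ˡ []      h       = []
  At-++⁻ˡ (a ∷ v) (e ∷ h) = e ∷ At-++⁻ˡ v h

  At-++⁻ʳ : ∀ {q} v {w} → At u q (v ++ w) → At u (q + length v) w
  At-++⁻ʳ {q} []      h       = At-cast (sym (+-identityʳ q)) h
  At-++⁻ʳ {q} (a ∷ v) (e ∷ h) = At-cast (sym (+-suc q _)) (At-++⁻ʳ v h)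

  At-drop : ∀ {q w} o → At u q w → At u (q + o) (drop o w)
  At-drop {q} zero    h       = At-cast (sym (+-identityʳ q)) h
  At-drop     (suc o) []      = []
  At-drop {q} (suc o) (e ∷ h) = At-cast (sym (+-suc q o)) (At-drop o h)

  At-sub : ∀ i n → At u i (sub u i n)
  At-sub i zero    = []
  At-sub i (suc n) = refl ∷ At-sub (suc i) n

  At⇒sub≡ : ∀ {i w} → At u i w → sub u i (length w) ≡ w
  At⇒sub≡ []      = refl
  At⇒sub≡ (e ∷ h) = cong₂ _∷_ e (At⇒sub≡ h)

  AtB-++⁻ˡ : ∀ {e} v {w} → AtB u e (v ++ w) → AtB u e v
  AtB-++⁻ˡ []      h       = []
  AtB-++⁻ˡ (a ∷ v) (p ∷ h) = p ∷ AtB-++⁻ˡ v h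

  AtB-++⁻ʳ : ∀ {e} v {w} → AtB u (e + length v) (v ++ w) → AtB u e w
  AtB-++⁻ʳ {e} []      h = AtB-cast (+-identityʳ e) h
  AtB-++⁻ʳ {e} (a ∷ v) h with AtB-cast (+-suc e (length v)) h
  ... | _ ∷ h′ = AtB-++⁻ʳ v h′

  At⇒AtB-acc : ∀ {q w acc} → At u q w → AtB u q acc → AtB u (q + length w) (w ʳ++ acc)
  At⇒AtB-acc {q} []      g = AtB-cast (sym (+-identityʳ q)) g
  At⇒AtB-acc {q} (e ∷ h) g = AtB-cast (sym (+-suc q _)) (At⇒AtB-acc h (e ∷ g))

  At⇒AtB : ∀ {q w} → At u q w → AtB u (q + length w) (reverse w)
  At⇒AtB h = At⇒AtB-acc h []

  AtB⇒At-acc : ∀ {e w acc} → AtB u e w → At u e acc →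
               ∃[ q ] q + length w ≡ e × At u q (w ʳ++ acc)
  AtB⇒At-acc {e} [] g = e , +-identityʳ e , g
  AtB⇒At-acc (p ∷ h) g with AtB⇒At-acc h (p ∷ g)
  ... | q , eq , k = q , trans (+-suc q _) (cong suc eq) , k

sub-length : ∀ (u : Seq) i n → length (sub u i n) ≡ n
sub-length u i zero    = refl
sub-length u i (suc n) = cong suc (sub-length u (suc i) n)

-- Holds when one of the words is a prefix of the other, as for any two words read at the same
-- position; a computed `false` therefore refutes an occurrence.
compat : Word → Word → Bool
compat []      _       = true
compat (_ ∷ _) []      = true
compat (a ∷ v) (b ∷ w) = ⌊ a ≟L b ⌋ ∧ compat v w

At-compat : ∀ {u q v w} → At u q v → At u q w → compat v w ≡ true
At-compat []      _       = refl
At-compat (_ ∷ _) []      = refl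
At-compat {v = a ∷ _} {b ∷ _} (e ∷ g) (f ∷ h) with a ≟L b
... | yes _  = At-compat g h
... | no a≢b = ⊥-elim (a≢b (trans (sym e) f))

AtB-compat : ∀ {u e v w} → AtB u e v → AtB u e w → compat v w ≡ true
AtB-compat []      _       = refl
AtB-compat (_ ∷ _) []      = refl
AtB-compat {v = a ∷ _} {b ∷ _} (e ∷ g) (f ∷ h) with a ≟L b
... | yes _  = AtB-compat g h
... | no a≢b = ⊥-elim (a≢b (trans (sym e) f))

-- Decision procedures for finite checks

_≟W_ : (v w : Word) → Dec (v ≡ w)
_≟W_ = ≡-dec _≟L_

∀Bool? : {P : Bool → Set} → (∀ τ → Dec (P τ)) → Dec (∀ τ → P τ)
∀Bool? {P} P? = map′ all (λ h → h true , h false) (P? true ×-dec P? false)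
  where
  all : P true × P false → ∀ τ → P τ
  all (p , _) true  = p
  all (_ , q) false = q

∀Letter? : {P : Letter → Set} → (∀ a → Dec (P a)) → Dec (∀ a → P a)
∀Letter? {P} P? = map′ all (λ h → h c0 , h c1 , h c2) (P? c0 ×-dec P? c1 ×-dec P? c2)
  where
  all : P c0 × P c1 × P c2 → ∀ a → P a
  all (p , _ , _) c0 = p
  all (_ , p , _) c1 = p
  all (_ , _ , p) c2 = p

∀<? : {P : ℕ → Set} → (∀ r → Dec (P r)) → ∀ n → Dec (∀ r → r < n → P r)
∀<? P? n = map′ (λ h r → h {r}) (λ h {r} → h r) (allUpTo? P? n)

take-prefix : ∀ n (v : Word) {w : Word} → take n w ≡ v → ∃[ K ] w ≡ v ++ K
take-prefix n _ {w} refl = drop n w , sym (take++drop≡id n w)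

-- Signs, block codes and the lifting of palindromic suffixes

-- classes of letters that cannot be told apart by a short context
data Kind : Set where
  any pair : Kind
  only     : Letter → Kind

mem : Kind → Letter → Bool
mem any      _  = true
mem pair     c0 = false
mem pair     _  = true
mem (only c) a  = ⌊ c ≟L a ⌋

mem-only : ∀ {c a} → mem (only c) a ≡ true → c ≡ a
mem-only {c} {a} h with c ≟L a
... | yes e = e

-- The sign of a position of x is the parity of the number of letters 2 before it.
nx : Letter → Bool → Bool
nx c2 τ = not τ
nx _  τ = τ

nx-involutive : ∀ a τ → nx a (nx a τ) ≡ τ
nx-involutive c0 τ = refl
nx-involutive c1 τ = refl
nx-involutive c2 τ = not-involutive τ

nxs : Word → Bool → Bool
nxs []      τ = τ
nxs (a ∷ s) τ = nxs s (nx a τ)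

nxs-∷ʳ : ∀ s a τ → nxs (s ∷ʳ a) τ ≡ nx a (nxs s τ)
nxs-∷ʳ []      a τ = refl
nxs-∷ʳ (b ∷ s) a τ = nxs-∷ʳ s a (nx b τ)

nxs-reverse : ∀ s τ → nxs (reverse s) (nxs s τ) ≡ τ
nxs-reverse []      τ = refl
nxs-reverse (a ∷ s) τ = begin
  nxs (reverse (a ∷ s)) (nxs s (nx a τ))    ≡⟨ cong (λ w → nxs w (nxs s (nx a τ))) (unfold-reverse a s) ⟩
  nxs (reverse s ∷ʳ a) (nxs s (nx a τ))     ≡⟨ nxs-∷ʳ (reverse s) a _ ⟩
  nx a (nxs (reverse s) (nxs s (nx a τ)))   ≡⟨ cong (nx a) (nxs-reverse s (nx a τ)) ⟩
  nx a (nx a τ)                             ≡⟨ nx-involutive a τ ⟩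
  τ ∎
  where open ≡-Reasoning

sgn : Seq → ℕ → Bool
sgn x zero    = true
sgn x (suc k) = nx (x k) (sgn x k)

pos : (Letter → ℕ) → Seq → ℕ → ℕ
pos len x zero    = 0
pos len x (suc k) = pos len x k + len (x k)

-- M τ is the marker, tail a r the r letters that follow it in front of a, and kind a r the set of
-- letters sharing these r letters with a.
record BlockCode (T : Bool → Letter → Word) (M : Bool → Word) (len : Letter → ℕ) (m : ℕ)
                 (kind : Letter → ℕ → Kind) : Set where

  TM : Bool → Letter → Word
  TM τ a = T τ a ++ M (nx a τ)

  tail : Letter → ℕ → Bool → Word
  tail a r τ = take r (drop m (TM τ a))

  field
    M-rev     : ∀ τ → reverse (M τ) ≡ M τ
    M-len     : ∀ τ → length (M τ) ≡ m
    m≥1       : 1 ≤ m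
    T-len     : ∀ τ a → length (T τ a) ≡ len a
    len≥1     : ∀ a → 1 ≤ len a
    TM-prefix : ∀ τ a → take m (TM τ a) ≡ M τ
    TM-rev    : ∀ τ a → reverse (TM τ a) ≡ TM (nx a τ) a
    TM-sync   : ∀ τ τ′ a o → o < len a → 1 ≤ o → compat (M τ′) (drop o (TM τ a)) ≡ true → ⊥
    TM-inj    : ∀ τ τ′ a c → compat (TM τ a) (TM τ′ c) ≡ true → a ≡ c
    kind-self : ∀ a r → r < len a → mem (kind a r) a ≡ true
    tail-len  : ∀ τ a r → r < len a → length (tail a r τ) ≡ r
    class⁺    : ∀ τ a c r → r < len a → 1 ≤ r → mem (kind a r) c ≡ true →
                take (m + r) (TM τ c) ≡ M τ ++ tail a r τ
    class⁻    : ∀ τ τ′ a c r → r < len a → 1 ≤ r →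
                compat (M τ ++ tail a r τ) (TM τ′ c) ≡ true → mem (kind a r) c ≡ true
    class-len : ∀ a c r → r < len a → 1 ≤ r → mem (kind a r) c ≡ true → r < len c

-- Both the palindrome and its competitors start at `m` or later. The value 1 serves to guarantee a
-- letter in front of the palindrome. In x, where signs leave no trace, `sw` is the identity; in z
-- it exchanges 1 and 2.
record PalSuffix (sw : Word → Word) (u : Seq) (m N : ℕ) : Set where
  constructor palSuffix
  field
    start    : ℕ
    word     : Word
    m≤start  : m ≤ start
    nonempty : 1 ≤ length word
    at       : At u start word
    ends     : start + length word ≡ N
    pal      : reverse word ≡ word ⊎ reverse word ≡ sw word
    unique   : ∀ q → m ≤ q → q < start → ¬ At u q word × ¬ At u q (sw word)

-- The palindrome may be empty, and its neighbours at `start` and `k` may be two different members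
-- of `κ`. Only earlier occurrences with both neighbours in `κ` are excluded.
record EnclosedPal (u : Seq) (κ : Kind) (k : ℕ) : Set where
  constructor enclosedPal
  field
    start  : ℕ
    word   : Word
    at     : At u (suc start) word
    ends   : suc start + length word ≡ k
    pal    : reverse word ≡ word
    before : mem κ (u start) ≡ true
    unique : ∀ q → q < start → mem κ (u q) ≡ true → At u (suc q) word →
             mem κ (u (suc q + length word)) ≡ true → ⊥

module Code (x u : Seq) (T : Bool → Letter → Word) (M : Bool → Word) (len : Letter → ℕ) (m : ℕ)
            (kind : Letter → ℕ → Kind) (code : BlockCode T M len m kind)
            (spec : ∀ k → At u (pos len x k) (BlockCode.TM code (sgn x k) (x k))) where

  open BlockCode code
  open ≡-Reasoning

  b : ℕ → ℕ
  b = pos len x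

  σ : ℕ → Bool
  σ = sgn x

  -- the image of s read with initial sign τ, closed by the word E attached to the final sign
  img : (Bool → Word) → Bool → Word → Word
  img E τ []      = E τ
  img E τ (a ∷ s) = T τ a ++ img E (nx a τ) s

  img-++ : ∀ (E F : Bool → Word) τ s → img (λ ρ → E ρ ++ F ρ) τ s ≡ img E τ s ++ F (nxs s τ)
  img-++ E F τ []      = refl
  img-++ E F τ (a ∷ s) = trans (cong (T τ a ++_) (img-++ E F (nx a τ) s)) (sym (++-assoc (T τ a) _ _))

  img-∷ʳ : ∀ τ s a K → M (nxs s τ) ++ K ≡ TM (nxs s τ) a → img M τ s ++ K ≡ img M τ (s ∷ʳ a)
  img-∷ʳ τ []      a K h = h
  img-∷ʳ τ (c ∷ s) a K h = trans (++-assoc (T τ c) _ _) (cong (T τ c ++_) (img-∷ʳ (nx c τ) s a K h))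

  -- By `TM-rev` a block closed by its marker is reversed into the block of the same letter at the
  -- sign after it, so the reversed image starts at the final sign.
  img-reverse : ∀ τ s → reverse (img M τ s) ≡ img M (nxs s τ) (reverse s)
  img-reverse τ []      = M-rev τ
  img-reverse τ (a ∷ s) = begin
    reverse (T τ a ++ img M τ′ s)             ≡⟨ reverse-++ (T τ a) _ ⟩
    reverse (img M τ′ s) ++ reverse (T τ a)   ≡⟨ cong (_++ reverse (T τ a)) (img-reverse τ′ s) ⟩
    img M τ″ (reverse s) ++ reverse (T τ a)   ≡⟨ img-∷ʳ τ″ (reverse s) a _ step ⟩
    img M τ″ (reverse s ∷ʳ a)                 ≡⟨ cong (img M τ″) (sym (unfold-reverse a s)) ⟩
    img M τ″ (reverse (a ∷ s)) ∎
    where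
    τ′ = nx a τ
    τ″ = nxs s τ′
    step : M (nxs (reverse s) τ″) ++ reverse (T τ a) ≡ TM (nxs (reverse s) τ″) a
    step rewrite nxs-reverse s τ′ = begin
      M τ′ ++ reverse (T τ a)            ≡⟨ cong (_++ reverse (T τ a)) (sym (M-rev τ′)) ⟩
      reverse (M τ′) ++ reverse (T τ a)  ≡⟨ sym (reverse-++ (T τ a) (M τ′)) ⟩
      reverse (TM τ a)                   ≡⟨ TM-rev τ a ⟩
      TM τ′ a                            ∎

  img-length : ∀ E n → (∀ ρ → length (E ρ) ≡ n) → ∀ τ i s → At x i s →
               b i + length (img E τ s) ≡ b (i + length s) + n
  img-length E n En τ i [] [] = cong₂ _+_ (cong b (sym (+-identityʳ i))) (En τ)
  img-length E n En τ i (a ∷ s) (e ∷ h) = begin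
    b i + length (T τ a ++ img E (nx a τ) s)        ≡⟨ cong (b i +_) (length-++ (T τ a)) ⟩
    b i + (length (T τ a) + length (img E (nx a τ) s))
      ≡⟨ cong (λ l → b i + (l + length (img E (nx a τ) s))) (trans (T-len τ a) (cong len (sym e))) ⟩
    b i + (len (x i) + length (img E (nx a τ) s))   ≡⟨ sym (+-assoc (b i) _ _) ⟩
    b (suc i) + length (img E (nx a τ) s)           ≡⟨ img-length E n En (nx a τ) (suc i) s h ⟩
    b (suc i + length s) + n                        ≡⟨ cong (λ j → b j + n) (sym (+-suc i (length s))) ⟩
    b (i + suc (length s)) + n ∎

  σ-+ : ∀ i s → At x i s → σ (i + length s) ≡ nxs s (σ i)
  σ-+ i []      []         = cong σ (+-identityʳ i)
  σ-+ i (a ∷ s) (refl ∷ h) = trans (cong σ (+-suc i (length s))) (σ-+ (suc i) s h)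

  at-img : ∀ E i s → At x i s → At u (b (i + length s)) (E (σ (i + length s))) →
           At u (b i) (img E (σ i) s)
  at-img E i []      []         g = subst (λ j → At u (b j) (E (σ j))) (+-identityʳ i) g
  at-img E i (a ∷ s) (refl ∷ h) g = At-++⁺ (At-++⁻ˡ (T (σ i) a) (spec i))
    (At-cast (cong (b i +_) (sym (T-len (σ i) a)))
      (at-img E (suc i) s h (subst (λ j → At u (b j) (E (σ j))) (+-suc i (length s)) g)))

  at-M : ∀ i → At u (b i) (M (σ i))
  at-M i with take-prefix m _ (TM-prefix (σ i) (x i)) | spec i
  ... | K , eq | h rewrite eq = At-++⁻ˡ (M (σ i)) h

  at-imgM : ∀ i s → At x i s → At u (b i) (img M (σ i) s)
  at-imgM i s h = at-img M i s h (at-M (i + length s))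

  b-mono : ∀ {i j} → i ≤ j → b i ≤ b j
  b-mono {zero}  {j}     _ = z≤n
  b-mono {suc i} {suc j} (s≤s h) with m≤n⇒m<n∨m≡n h
  ... | inj₂ refl = ≤-refl
  ... | inj₁ i<j  = ≤-trans (b-mono {suc i} {j} i<j) (m≤m+n (b j) _)

  n≤b : ∀ n → n ≤ b n
  n≤b zero    = z≤n
  n≤b (suc n) = ≤-trans (≤-reflexive (+-comm 1 n)) (+-mono-≤ (n≤b n) (len≥1 (x n)))

  b-cancel-< : ∀ {i j} → b i < b j → i < j
  b-cancel-< {i} {j} h with i <? j
  ... | yes p = p
  ... | no ¬p = ⊥-elim (<⇒≱ h (b-mono (≮⇒≥ ¬p)))

  locate : ∀ q → ∃₂ λ i o → q ≡ b i + o × o < len (x i)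
  locate zero    = 0 , 0 , refl , len≥1 (x 0)
  locate (suc q) with locate q
  ... | i , o , refl , o< with suc o <? len (x i)
  ...   | yes so< = i , suc o , sym (+-suc (b i) o) , so<
  ...   | no  so≮ = suc i , 0 , trans (trans (sym (+-suc (b i) o)) (cong (b i +_) (≤-antisym o< (≮⇒≥ so≮))))
                                      (sym (+-identityʳ _)) , len≥1 (x (suc i))

  sync : ∀ q τ → At u q (M τ) → ∃[ i ] q ≡ b i
  sync q τ h with locate q
  ... | i , zero  , eq   , _  = i , trans eq (+-identityʳ (b i))
  ... | i , suc o , refl , o< =
    ⊥-elim (TM-sync (σ i) τ (x i) (suc o) o< (s≤s z≤n) (At-compat h (At-drop (suc o) (spec i))))

  img-prefix : ∀ E → (∀ ρ → ∃[ K ] E ρ ≡ M ρ ++ K) → ∀ τ s → ∃[ K ] img E τ s ≡ M τ ++ K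
  img-prefix E EM τ []      = EM τ
  img-prefix E EM τ (a ∷ s) with img-prefix E EM (nx a τ) s | take-prefix m _ (TM-prefix τ a)
  ... | K , eq | L , eq′ = L ++ K , (begin
    T τ a ++ img E (nx a τ) s     ≡⟨ cong (T τ a ++_) eq ⟩
    T τ a ++ M (nx a τ) ++ K      ≡⟨ sym (++-assoc (T τ a) _ _) ⟩
    TM τ a ++ K                   ≡⟨ cong (_++ K) eq′ ⟩
    (M τ ++ L) ++ K               ≡⟨ ++-assoc (M τ) L K ⟩
    M τ ++ L ++ K ∎)

  -- `TM-inj` compares blocks across signs, so the letters are recovered even if `τ` is not known to
  -- be the sign of position `i`.
  decode : ∀ E → (∀ ρ → ∃[ K ] E ρ ≡ M ρ ++ K) → ∀ τ i s → At u (b i) (img E τ s) →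
           At x i s × ∃[ ρ ] At u (b (i + length s)) (E ρ)
  decode E EM τ i []      h = [] , τ , At-cast (cong b (sym (+-identityʳ i))) h
  decode E EM τ i (a ∷ s) h with img-prefix E EM (nx a τ) s
  ... | K , eq with TM-inj (σ i) τ (x i) a
                      (At-compat (spec i) (At-++⁻ˡ (TM τ a) (subst (At u (b i))
                        (trans (cong (T τ a ++_) eq) (sym (++-assoc (T τ a) _ _))) h)))
  ...   | refl with decode E EM (nx a τ) (suc i) s
                      (At-cast (cong (b i +_) (T-len τ a)) (At-++⁻ʳ (T τ a) h))
  ...     | g , ρ , g′ = refl ∷ g , ρ , At-cast (cong b (sym (+-suc i (length s)))) g′

  -- t τ is the word read after a marker of sign τ
  wrap : (Bool → Word) → Word → Bool → Word
  wrap t s τ = reverse (t τ) ++ img (λ ρ → M ρ ++ t ρ) τ s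

  wrap-reverse : ∀ t s → reverse s ≡ s → ∀ τ → reverse (wrap t s τ) ≡ wrap t s (nxs s τ)
  wrap-reverse t s ps τ = begin
    reverse (reverse (t τ) ++ img Mt τ s)
      ≡⟨ reverse-++ (reverse (t τ)) _ ⟩
    reverse (img Mt τ s) ++ reverse (reverse (t τ))
      ≡⟨ cong₂ (λ v w → reverse v ++ w) (img-++ M t τ s) (reverse-involutive (t τ)) ⟩
    reverse (img M τ s ++ t τ′) ++ t τ
      ≡⟨ cong (_++ t τ) (reverse-++ (img M τ s) (t τ′)) ⟩
    (reverse (t τ′) ++ reverse (img M τ s)) ++ t τ
      ≡⟨ ++-assoc (reverse (t τ′)) _ _ ⟩
    reverse (t τ′) ++ reverse (img M τ s) ++ t τ
      ≡⟨ cong (λ w → reverse (t τ′) ++ w ++ t τ) (trans (img-reverse τ s) (cong (img M τ′) ps)) ⟩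
    reverse (t τ′) ++ img M τ′ s ++ t τ
      ≡⟨ cong (λ ρ → reverse (t τ′) ++ img M τ′ s ++ t ρ) (sym back) ⟩
    reverse (t τ′) ++ img M τ′ s ++ t (nxs s τ′)
      ≡⟨ cong (reverse (t τ′) ++_) (sym (img-++ M t τ′ s)) ⟩
    wrap t s τ′ ∎
    where
    Mt = λ ρ → M ρ ++ t ρ
    τ′ = nxs s τ
    back : nxs s τ′ ≡ τ
    back = trans (cong (λ w → nxs w τ′) (sym ps)) (nxs-reverse s τ)

  -- Newness is stated for every initial sign `ρ`; in z this covers both the word and its image
  -- under the exchange of 1 and 2.
  record Lifted (w N : ℕ) : Set where
    constructor lifted
    field
      q        : ℕ
      τ        : Bool
      t        : Bool → Word
      s        : Word
      w≤q      : w ≤ q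
      nonempty : 1 ≤ length (wrap t s τ)
      at       : At u q (wrap t s τ)
      ends     : q + length (wrap t s τ) ≡ N
      pal      : reverse s ≡ s
      form     : t ≡ (λ _ → []) ⊎ (∃₂ λ a r → t ≡ tail a r)
      unique   : ∀ p → w ≤ p → p < q → ∀ ρ → ¬ At u p (wrap t s ρ)

  -- An earlier occurrence of the widened image contains a marker, hence starts `r` letters before
  -- some boundary `b j`. It decodes to an earlier occurrence of `s` with the tails on both sides,
  -- which the last hypothesis forbids.
  lift : ∀ w r (t : Bool → Word) i s → (∀ ρ → length (t ρ) ≡ r) →
         t ≡ (λ _ → []) ⊎ (∃₂ λ a r′ → t ≡ tail a r′) →
         At x i s → reverse s ≡ s → w + r ≤ b i →
         AtB u (b i) (t (σ i)) →
         At u (b (i + length s)) (M (σ (i + length s)) ++ t (σ (i + length s))) →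
         (∀ j → j < i → At x j s → w + r ≤ b j → ∀ τ → AtB u (b j + m) (M τ ++ t τ) →
            ∀ ρ → At u (b (j + length s)) (M ρ ++ t ρ) → ⊥) →
         Lifted w (b (i + length s) + (m + r))
  lift w r t i s tr fm hs ps wr left right uniq
    with AtB⇒At-acc left (at-img (λ ρ → M ρ ++ t ρ) i s hs right)
  ... | q , eq , h = lifted q (σ i) t s
      (+-cancelʳ-≤ r w q (≤-trans wr (≤-reflexive (trans (sym eq) (cong (q +_) (tr (σ i)))))))
      nonempty at′ len-eq ps fm uniq′
    where
    Mt = λ ρ → M ρ ++ t ρ
    Mt-len : ∀ ρ → length (Mt ρ) ≡ m + r
    Mt-len ρ = trans (length-++ (M ρ)) (cong₂ _+_ (M-len ρ) (tr ρ))
    Mt-prefix : ∀ ρ → ∃[ K ] Mt ρ ≡ M ρ ++ K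
    Mt-prefix ρ = t ρ , refl
    at′ : At u q (wrap t s (σ i))
    at′ = subst (At u q) (ʳ++-defn (t (σ i))) h
    len-eq : q + length (wrap t s (σ i)) ≡ b (i + length s) + (m + r)
    len-eq = begin
      q + length (wrap t s (σ i))
        ≡⟨ cong (q +_) (length-++ (reverse (t (σ i)))) ⟩
      q + (length (reverse (t (σ i))) + length (img Mt (σ i) s))
        ≡⟨ sym (+-assoc q _ _) ⟩
      q + length (reverse (t (σ i))) + length (img Mt (σ i) s)
        ≡⟨ cong (λ l → q + l + length (img Mt (σ i) s)) (length-reverse (t (σ i))) ⟩
      q + length (t (σ i)) + length (img Mt (σ i) s)
        ≡⟨ cong (_+ length (img Mt (σ i) s)) eq ⟩
      b i + length (img Mt (σ i) s)
        ≡⟨ img-length Mt (m + r) Mt-len (σ i) i s hs ⟩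
      b (i + length s) + (m + r) ∎
    nonempty : 1 ≤ length (wrap t s (σ i))
    nonempty = +-cancelˡ-≤ q 1 _ (≤-trans (≤-trans (+-mono-≤ q≤ (≤-trans m≥1 (m≤m+n m r))) ≤-refl)
                                          (≤-reflexive (sym len-eq)))
      where
      q≤ : q ≤ b (i + length s)
      q≤ = ≤-trans (m≤m+n q _) (≤-trans (≤-reflexive eq) (b-mono (m≤m+n i (length s))))
    uniq′ : ∀ p → w ≤ p → p < q → ∀ ρ → ¬ At u p (wrap t s ρ)
    uniq′ p w≤p p<q ρ g with img-prefix Mt Mt-prefix ρ s
    ... | K , eqK = contra (sync p′ ρ atM)
      where
      p′ = p + length (reverse (t ρ))
      g₁ : At u p′ (img Mt ρ s)
      g₁ = At-++⁻ʳ (reverse (t ρ)) g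
      atM : At u p′ (M ρ)
      atM = At-++⁻ˡ (M ρ) (subst (At u p′) eqK g₁)
      p′≡ : p′ ≡ p + r
      p′≡ = cong (p +_) (trans (length-reverse (t ρ)) (tr ρ))
      g₂ : AtB u p′ (t ρ)
      g₂ = subst (AtB u p′) (reverse-involutive (t ρ)) (At⇒AtB (At-++⁻ˡ (reverse (t ρ)) g))
      g₃ : AtB u (p′ + m) (M ρ ++ t ρ)
      g₃ = subst₂ (λ e v → AtB u (p′ + e) v) (M-len ρ)
             (trans (ʳ++-defn (M ρ)) (cong (_++ t ρ) (M-rev ρ))) (At⇒AtB-acc atM g₂)
      contra : ∃[ j ] p′ ≡ b j → ⊥
      contra (j , p′≡bj) with decode Mt Mt-prefix ρ j s (At-cast p′≡bj g₁)
      ... | hj , ρ′ , gE = uniq j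
              (b-cancel-< (≤-trans (≤-reflexive (cong suc (trans (sym p′≡bj) p′≡)))
                (≤-trans (+-monoˡ-< r p<q) (≤-reflexive (trans (cong (q +_) (sym (tr (σ i)))) eq)))))
              hj (≤-trans (+-monoˡ-≤ r w≤p) (≤-reflexive (trans (sym p′≡) p′≡bj)))
              ρ (AtB-cast (cong (_+ m) p′≡bj) g₃) ρ′ gE

  lift-aligned : ∀ w k → (∀ j → w ≤ j → w ≤ b j) → (∀ j → w ≤ b j → w ≤ j) →
                 PalSuffix id x w k → Lifted w (b k + m)
  lift-aligned w _ up down (palSuffix i s w≤i _ hs refl ps un) =
    subst (λ n → Lifted w (b (i + length s) + n)) (+-identityʳ m)
      (lift w 0 (λ _ → []) i s (λ _ → refl) (inj₁ refl) hs ([ id , id ]′ ps)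
        (≤-trans (≤-reflexive (+-identityʳ w)) (up i w≤i)) []
        (subst (At u _) (sym (++-identityʳ _)) (at-M (i + length s)))
        (λ j j<i hj wj _ _ _ _ → un j (down j (≤-trans (≤-reflexive (sym (+-identityʳ w))) wj)) j<i .proj₁ hj))

  -- The `r` letters after a marker reveal only the class of the letter, so the reflection takes
  -- place about a palindrome enclosed by two letters of that class. Read backwards with its closing
  -- marker, the left block looks like a block by `TM-rev`.
  lift-inner : ∀ w k r → w ≤ 1 → 1 ≤ r → r < len (x k) → EnclosedPal x (kind (x k) r) k →
               Lifted w (b k + (m + r))
  lift-inner w _ r w≤1 1≤r r< (enclosedPal i s hs refl ps be un) =
    lift w r t (suc i) s (λ ρ → tail-len ρ a r r<) (inj₂ (a , r , refl)) hs ps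
      -- The block in front of the palindrome has more than `r` letters, which leaves room for the
      -- tail and for a start at `w` ≤ 1.
      (≤-trans (≤-trans (+-monoˡ-≤ r w≤1) (class-len a (x i) r r< 1≤r be)) (m≤n+m (len (x i)) (b i)))
      left right uniq
    where
    k = suc i + length s
    a = x k
    t = tail a r
    spec-left : ∀ j → AtB u (b (suc j) + m) (TM (σ (suc j)) (x j))
    spec-left j = subst₂ (AtB u)
      (trans (cong (b j +_) (trans (length-++ (T (σ j) (x j))) (cong₂ _+_ (T-len (σ j) (x j)) (M-len _))))
             (sym (+-assoc (b j) _ m)))
      (TM-rev (σ j) (x j)) (At⇒AtB (spec j))
    left : AtB u (b (suc i)) (t (σ (suc i)))
    left with take-prefix (m + r) _ (class⁺ (σ (suc i)) a (x i) r r< 1≤r be)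
    ... | K , eq = AtB-++⁻ʳ (M (σ (suc i))) (AtB-cast (cong (b (suc i) +_) (sym (M-len _)))
            (AtB-++⁻ˡ (M (σ (suc i)) ++ t (σ (suc i))) (subst (AtB u _) eq (spec-left i))))
    right : At u (b k) (M (σ k) ++ t (σ k))
    right with take-prefix (m + r) _ (class⁺ (σ k) a a r r< 1≤r (kind-self a r r<))
    ... | K , eq = At-++⁻ˡ (M (σ k) ++ t (σ k)) (subst (At u (b k)) eq (spec k))
    uniq : ∀ j → j < suc i → At x j s → w + r ≤ b j → ∀ τ → AtB u (b j + m) (M τ ++ t τ) →
           ∀ ρ → At u (b (j + length s)) (M ρ ++ t ρ) → ⊥
    uniq zero    _         _  wr0 = ⊥-elim (<⇒≱ 1≤r (m+n≤o⇒n≤o w wr0))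
    uniq (suc j) (s≤s j<i) hj _ τ l ρ g = un j j<i
      (class⁻ τ (σ (suc j)) a (x j) r r< 1≤r (AtB-compat l (spec-left j))) hj
      (class⁻ ρ (σ (suc j + length s)) a (x (suc j + length s)) r r< 1≤r (At-compat g (spec _)))

-- Prefixes of the fixed point and of its image

blocks : (Bool → Letter → Word) → Bool → Word → Word
blocks T τ []      = []
blocks T τ (a ∷ w) = T τ a ++ blocks T (nx a τ) w

blocks-++ : ∀ T τ v w → blocks T τ (v ++ w) ≡ blocks T τ v ++ blocks T (nxs v τ) w
blocks-++ T τ []      w = refl
blocks-++ T τ (a ∷ v) w = trans (cong (T τ a ++_) (blocks-++ T (nx a τ) v w)) (sym (++-assoc (T τ a) _ _))

sub-++ : ∀ (u : Seq) i m n → sub u i (m + n) ≡ sub u i m ++ sub u (i + m) n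
sub-++ u i zero    n = cong (λ j → sub u j n) (sym (+-identityʳ i))
sub-++ u i (suc m) n = cong (u i ∷_) (trans (sub-++ u (suc i) m n)
                         (cong (λ j → sub u (suc i) m ++ sub u j n) (sym (+-suc i m))))

pre-cong : ∀ (u v : Seq) n → (∀ k → u k ≡ v k) → pre u n ≡ pre v n
pre-cong u v zero    h = refl
pre-cong u v (suc n) h = cong₂ _∷_ (h 0) (pre-cong (u ∘ suc) (v ∘ suc) n (h ∘ suc))

factorAt≡sub : ∀ u i n → factorAt u i n ≡ sub u i n
factorAt≡sub u i zero    = refl
factorAt≡sub u i (suc n) = cong₂ _∷_ (cong u (+-identityʳ i))
  (trans (pre-cong _ (λ k → u (suc i + k)) n (λ k → cong u (+-suc i k))) (factorAt≡sub u (suc i) n))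

prefix⇒At : ∀ u w → IsPrefixOf w u → At u 0 w
prefix⇒At u w h = subst (At u 0) (trans (sym (factorAt≡sub u 0 (length w))) h) (At-sub {u} 0 (length w))

At-blocks : ∀ T len x u → (∀ τ a → length (T τ a) ≡ len a) →
            (∀ n → At u 0 (blocks T true (sub x 0 n))) →
            ∀ k n → At u (pos len x k) (blocks T (sgn x k) (sub x k n))
At-blocks T len x u T-len h zero    n = h n
At-blocks T len x u T-len h (suc k) n =
  At-cast (cong (pos len x k +_) (T-len (sgn x k) (x k)))
    (At-++⁻ʳ (T (sgn x k) (x k)) (At-blocks T len x u T-len h k (suc n)))

-- A marker can be longer than the block it opens, as for the letter 2 in z (18 against 16 letters),
-- so it is read off two consecutive blocks.
At-TM : ∀ (T : Bool → Letter → Word) (M : Bool → Word) len m x u → (∀ τ a → length (T τ a) ≡ len a) →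
        (∀ τ a c → take m (T τ a ++ T (nx a τ) c) ≡ M τ) →
        (∀ n → At u 0 (blocks T true (sub x 0 n))) →
        ∀ k → At u (pos len x k) (T (sgn x k) (x k) ++ M (sgn x (suc k)))
At-TM T M len m x u T-len tk h k =
  At-++⁺ (At-++⁻ˡ (T (sgn x k) (x k)) (At-blocks T len x u T-len h k 1))
    (At-cast (cong (pos len x k +_) (sym (T-len (sgn x k) (x k))))
      (subst (At u p) (tk (sgn x (suc k)) (x (suc k)) (x (suc (suc k))))
        (At-++⁻ˡ (take m w) (subst (At u p) (sym (take++drop≡id m w))
          (subst (At u p) eq (At-blocks T len x u T-len h (suc k) 2))))))
  where
  p = pos len x (suc k)
  w = T (sgn x (suc k)) (x (suc k)) ++ T (sgn x (suc (suc k))) (x (suc (suc k)))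
  eq : blocks T (sgn x (suc k)) (sub x (suc k) 2) ≡ w
  eq = cong (T (sgn x (suc k)) (x (suc k)) ++_) (++-identityʳ _)

-- Base cases by search in a finite prefix

nth : Word → ℕ → Letter
nth []      _       = c0
nth (a ∷ w) zero    = a
nth (a ∷ w) (suc i) = nth w i

At-nth : ∀ {u q w} → At u q w → ∀ i → i < length w → u (q + i) ≡ nth w i
At-nth {u} {q} (e ∷ h) zero    _         = trans (cong u (+-identityʳ q)) e
At-nth {u} {q} (e ∷ h) (suc i) (s≤s i<n) = trans (cong u (+-suc q i)) (At-nth h i i<n)

module Search (X : Word) where

  slice : ℕ → ℕ → Word
  slice i N = take (N ∸ i) (drop i X)

  At-slice : ∀ {u} → At u 0 X → ∀ i N → At u i (slice i N)
  At-slice h i N = At-++⁻ˡ (slice i N)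
    (subst (At _ i) (sym (take++drop≡id (N ∸ i) (drop i X))) (At-drop i h))

  GoodStart : (Word → Word) → ℕ → ℕ → ℕ → Set
  GoodStart sw w N i = w ≤ i × 1 ≤ length V × i + length V ≡ N ×
    (reverse V ≡ V ⊎ reverse V ≡ sw V) ×
    (∀ q → q < i → w ≤ q → ¬ compat V (drop q X) ≡ true × ¬ compat (sw V) (drop q X) ≡ true)
    where V = slice i N

  goodStart? : ∀ sw w N i → Dec (GoodStart sw w N i)
  goodStart? sw w N i = w ≤? i ×-dec 1 ≤? length V ×-dec (i + length V ≟ N) ×-dec
    ((reverse V ≟W V) ⊎-dec (reverse V ≟W sw V)) ×-dec
    ∀<? (λ q → w ≤? q →-dec (¬? (compat V (drop q X) Bool.≟ true) ×-dec
                            ¬? (compat (sw V) (drop q X) Bool.≟ true))) i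
    where V = slice i N

  palSuffixes? : ∀ sw w lo hi → Dec (∀ N → N < hi → lo ≤ N → ∃[ i ] i < N × GoodStart sw w N i)
  palSuffixes? sw w lo hi = ∀<? (λ N → lo ≤? N →-dec anyUpTo? (goodStart? sw w N) N) hi

  goodStart⇒palSuffix : ∀ {u sw w N} → At u 0 X → (∃[ i ] i < N × GoodStart sw w N i) → PalSuffix sw u w N
  goodStart⇒palSuffix h (i , _ , w≤i , ne , en , ps , un) =
    palSuffix i _ w≤i ne (At-slice h i _) en ps
      (λ q w≤q q<i → (λ g → proj₁ (un q q<i w≤q) (At-compat g (At-drop q h))) ,
                     (λ g → proj₂ (un q q<i w≤q) (At-compat g (At-drop q h))))

  GoodEnclosure : Kind → ℕ → ℕ → Set
  GoodEnclosure κ k i = suc i + length V ≡ k × reverse V ≡ V × mem κ (nth X i) ≡ true ×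
    (∀ q → q < i → mem κ (nth X q) ≡ true → compat V (drop (suc q) X) ≡ true →
       mem κ (nth X (suc q + length V)) ≡ true → ⊥)
    where V = slice (suc i) k

  goodEnclosure? : ∀ κ k i → Dec (GoodEnclosure κ k i)
  goodEnclosure? κ k i = (suc i + length V ≟ k) ×-dec (reverse V ≟W V) ×-dec
    (mem κ (nth X i) Bool.≟ true) ×-dec
    ∀<? (λ q → (mem κ (nth X q) Bool.≟ true) →-dec (compat V (drop (suc q) X) Bool.≟ true) →-dec
               ¬? (mem κ (nth X (suc q + length V)) Bool.≟ true)) i
    where V = slice (suc i) k

  enclosures? : ∀ κ lo hi → Dec (∀ k → k < hi → lo ≤ k → mem κ (nth X k) ≡ true →
                                 ∃[ i ] i < k × GoodEnclosure κ k i)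
  enclosures? κ lo hi = ∀<? (λ k → lo ≤? k →-dec (mem κ (nth X k) Bool.≟ true) →-dec
                                   anyUpTo? (goodEnclosure? κ k) k) hi

  goodEnclosure⇒enclosedPal : ∀ {u κ k} → At u 0 X → k < length X → (∃[ i ] i < k × GoodEnclosure κ k i) →
                              EnclosedPal u κ k
  goodEnclosure⇒enclosedPal {u} {κ} {k} h k< (i , i<k , en , ps , be , un) =
    enclosedPal i V (At-slice h (suc i) k) en ps (subst (λ a → mem κ a ≡ true) (sym (at i (<-trans i<k k<))) be)
      (λ q q<i me g me′ → un q q<i
        (subst (λ a → mem κ a ≡ true) (at q (<-trans q<i (<-trans i<k k<))) me)
        (At-compat g (At-drop (suc q) h))
        (subst (λ a → mem κ a ≡ true)
          (at (suc q + length V) (<-trans (≤-trans (+-monoˡ-< (length V) (s≤s q<i)) (≤-reflexive en)) k<))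
          me′))
    where
    V = slice (suc i) k
    at : ∀ j → j < length X → u j ≡ nth X j
    at = At-nth h

pal-∷ : ∀ {a : Letter} {v} → 1 ≤ length v → reverse (a ∷ v) ≡ a ∷ v →
        ∃[ s ] v ≡ s ∷ʳ a × reverse s ≡ s
pal-∷ {a} {v} 1≤ h with initLast v
... | s ∷ʳ′ c with trans (sym (cong (_∷ʳ a) (reverse-++ s (c ∷ [])))) (trans (sym (unfold-reverse a (s ∷ʳ c))) h)
...   | eq with ∷-injective eq
...     | refl , eq′ = s , refl , ∷ʳ-injectiveˡ (reverse s) s eq′

-- The block code of f and the palindromes of x

lenF : Letter → ℕ
lenF a = length (fL a)

-- After the marker 0 the blocks 01, 022, 02 continue with 1, 22, 2: one letter 2 does not separate
-- 1 from 2, a second one does.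
kindF : Letter → ℕ → Kind
kindF c0 _             = only c0
kindF c2 _             = pair
kindF c1 (suc (suc _)) = only c1
kindF c1 _             = pair

fT : Bool → Letter → Word
fT _ = fL

fM : Bool → Word
fM _ = c0 ∷ []

fCode : BlockCode fT fM lenF 1 kindF
fCode = record
  { M-rev     = λ _ → refl
  ; M-len     = λ _ → refl
  ; m≥1       = s≤s z≤n
  ; T-len     = λ _ _ → refl
  ; len≥1     = from-yes (∀Letter? λ a → 1 ≤? lenF a)
  ; TM-prefix = from-yes (∀Bool? λ τ → ∀Letter? λ a → take 1 (fTM a) ≟W fM τ)
  ; TM-rev    = from-yes (∀Bool? λ τ → ∀Letter? λ a → reverse (fTM a) ≟W fTM a)
  ; TM-sync   = from-yes (∀Bool? λ τ → ∀Bool? λ τ′ → ∀Letter? λ a → ∀<? (λ o →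
                  1 ≤? o →-dec ¬? (compat (fM τ′) (drop o (fTM a)) Bool.≟ true)) (lenF a))
  ; TM-inj    = from-yes (∀Bool? λ τ → ∀Bool? λ τ′ → ∀Letter? λ a → ∀Letter? λ c →
                  (compat (fTM a) (fTM c) Bool.≟ true) →-dec (a ≟L c))
  ; kind-self = from-yes (∀Letter? λ a → ∀<? (λ r → mem (kindF a r) a Bool.≟ true) (lenF a))
  ; tail-len  = from-yes (∀Bool? λ τ → ∀Letter? λ a → ∀<? (λ r → length (ft a r) ≟ r) (lenF a))
  ; class⁺    = from-yes (∀Bool? λ τ → ∀Letter? λ a → ∀Letter? λ c → P<? a λ r →
                  1 ≤? r →-dec (mem (kindF a r) c Bool.≟ true) →-dec
                  (take (1 + r) (fTM c) ≟W (fM τ ++ ft a r)))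
  ; class⁻    = from-yes (∀Bool? λ τ → ∀Bool? λ τ′ → ∀Letter? λ a → ∀Letter? λ c → P<? a λ r →
                  1 ≤? r →-dec (compat (fM τ ++ ft a r) (fTM c) Bool.≟ true) →-dec
                  (mem (kindF a r) c Bool.≟ true))
  ; class-len = from-yes (∀Letter? λ a → ∀Letter? λ c → P<? a λ r →
                  1 ≤? r →-dec (mem (kindF a r) c Bool.≟ true) →-dec (suc r ≤? lenF c))
  }
  where
  fTM : Letter → Word
  fTM a = fL a ++ c0 ∷ []
  ft : Letter → ℕ → Word
  ft a r = take r (drop 1 (fTM a))
  P<? : ∀ a {P : ℕ → Set} → (∀ r → Dec (P r)) → Dec (∀ r → r < lenF a → P r)
  P<? a P? = ∀<? P? (lenF a)

fW-blocks : ∀ τ w → fW w ≡ blocks fT τ w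
fW-blocks τ []      = refl
fW-blocks τ (a ∷ w) = cong (fL a ++_) (fW-blocks (nx a τ) w)

fW-length : ∀ w → length w ≤ length (fW w)
fW-length []      = z≤n
fW-length (a ∷ w) = ≤-trans (+-mono-≤ (BlockCode.len≥1 fCode a) (fW-length w))
                            (≤-reflexive (sym (length-++ (fL a))))

iter-fW : ∀ n → ∃[ w ] iter n fW (c0 ∷ []) ≡ c0 ∷ w × n ≤ length w
iter-fW zero    = [] , refl , z≤n
iter-fW (suc n) with iter-fW n
... | w , eq , n≤ rewrite eq = c1 ∷ fW w , refl , s≤s (≤-trans n≤ (fW-length w))

fW-++ : ∀ v w → fW (v ++ w) ≡ fW v ++ fW w
fW-++ v w = trans (fW-blocks true (v ++ w)) (trans (blocks-++ fT true v w)
              (cong₂ _++_ (sym (fW-blocks true v)) (sym (fW-blocks (nxs v true) w))))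

module Fixed (x : Seq) (hx : ∀ n → IsPrefixOf (iter n fW (c0 ∷ [])) x) where

  -- The n-th iterate has more than n letters and so covers `sub x 0 n`; one more application of f
  -- gives the next iterate, again a prefix of x.
  x-prefix : ∀ n → At x 0 (fW (sub x 0 n))
  x-prefix n with iter-fW n | prefix⇒At x _ (hx n) | prefix⇒At x _ (hx (suc n))
  ... | w , eq , n≤ | h | h′ = At-++⁻ˡ (fW (sub x 0 n)) (subst (At x 0) eq″ h′)
    where
    ln : length (iter n fW (c0 ∷ [])) ≡ n + (length (iter n fW (c0 ∷ [])) ∸ n)
    ln = sym (m+[n∸m]≡n (≤-trans n≤ (≤-trans (n≤1+n _) (≤-reflexive (sym (cong length eq))))))
    d = length (iter n fW (c0 ∷ [])) ∸ n
    eq″ : fW (iter n fW (c0 ∷ [])) ≡ fW (sub x 0 n) ++ fW (sub x n d)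
    eq″ = trans (cong fW (trans (sym (At⇒sub≡ h)) (trans (cong (sub x 0) ln) (sub-++ x 0 n d))))
                (fW-++ (sub x 0 n) (sub x n d))

  f-blocks : ∀ n → At x 0 (blocks fT true (sub x 0 n))
  f-blocks n = subst (At x 0) (fW-blocks true (sub x 0 n)) (x-prefix n)

  f-spec : ∀ k → At x (pos lenF x k) (BlockCode.TM fCode (sgn x k) (x k))
  f-spec = At-TM fT fM lenF 1 x x (λ _ _ → refl)
    (from-yes (∀Bool? λ τ → ∀Letter? λ a → ∀Letter? λ c → take 1 (fL a ++ fL c) ≟W fM τ)) f-blocks

  open Code x x fT fM lenF 1 kindF fCode f-spec public

  x-start : At x 0 (iter 5 fW (c0 ∷ []))
  x-start = prefix⇒At x _ (hx 5)

  img-const : ∀ (t : Bool → Word) → (∀ τ τ′ → t τ ≡ t τ′) → ∀ s τ τ′ → img t τ s ≡ img t τ′ s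
  img-const t tc []      τ τ′ = tc τ τ′
  img-const t tc (a ∷ s) τ τ′ = cong (fL a ++_) (img-const t tc s (nx a τ) (nx a τ′))

  lifted⇒palSuffix : ∀ {w N} → Lifted w N → PalSuffix id x w N
  lifted⇒palSuffix (lifted q τ t s w≤q ne at en ps fm un) =
    palSuffix q (wrap t s τ) w≤q ne at en (inj₁ (trans (wrap-reverse t s ps τ) (const (nxs s τ) τ)))
      (λ p w≤p p<q → un p w≤p p<q τ , un p w≤p p<q τ)
    where
    tc : ∀ ρ ρ′ → t ρ ≡ t ρ′
    tc ρ ρ′ = [ (λ e → cong-app′ e) , (λ (_ , _ , e) → cong-app′ e) ]′ fm
      where
      cong-app′ : ∀ {v} → t ≡ (λ _ → v) → t ρ ≡ t ρ′
      cong-app′ refl = refl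
    const : ∀ ρ ρ′ → wrap t s ρ ≡ wrap t s ρ′
    const ρ ρ′ = cong₂ _++_ (cong reverse (tc ρ ρ′)) (img-const _ (λ _ _ → cong (c0 ∷_) (tc _ _)) s ρ ρ′)

  X : Word
  X = iter 5 fW (c0 ∷ [])

  x-nth : ∀ i → i < length X → x i ≡ nth X i
  x-nth = At-nth {x} {0} {X} x-start

  early-letter : ∀ a → ∃[ j ] j < 4 × x j ≡ a
  early-letter c0 = 0 , s≤s z≤n , x-nth 0 (s≤s z≤n)
  early-letter c1 = 1 , s≤s (s≤s z≤n) , x-nth 1 (s≤s (s≤s z≤n))
  early-letter c2 = 3 , ≤-refl , x-nth 3 (s≤s (s≤s (s≤s (s≤s z≤n))))

  enclosed-by-ends : ∀ k i a v → 1 ≤ length v → At x i (a ∷ v) → i + suc (length v) ≡ suc k →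
                     reverse (a ∷ v) ≡ a ∷ v → (∀ q → q < i → ¬ At x q (a ∷ v)) →
                     EnclosedPal x (only (x k)) k
  enclosed-by-ends k i a v 1≤ (e ∷ h) en ps un with pal-∷ 1≤ ps
  ... | s , refl , ps′ = enclosedPal i s (At-++⁻ˡ s h) en′ ps′ (mem-self (trans xk (sym e)))
          (λ q q<i me g me′ → un q q<i
             (trans (sym (mem-only me)) xk ∷ At-++⁺ g (trans (sym (mem-only me′)) xk ∷ [])))
    where
    en′ : suc i + length s ≡ k
    en′ = suc-injective (trans (cong suc (sym (+-suc i (length s))))
            (trans (sym (+-suc i (suc (length s)))) (trans (cong (i +_) (sym
              (trans (cong suc (length-++ s)) (cong suc (+-comm (length s) 1))))) en)))
    xk : x k ≡ a
    xk with At-++⁻ʳ s h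
    ... | e′ ∷ [] = trans (cong x (sym en′)) e′
    mem-self : ∀ {c d} → c ≡ d → mem (only c) d ≡ true
    mem-self {c0} refl = refl
    mem-self {c1} refl = refl
    mem-self {c2} refl = refl

  -- The letters 0102 at the start of x exhaust the alphabet, so from position 4 on a new
  -- palindromic suffix has at least two letters; stripping its equal ends leaves the enclosed
  -- palindrome.
  enclosed-only : ∀ k → 4 ≤ k → PalSuffix id x 0 (suc k) → EnclosedPal x (only (x k)) k
  enclosed-only k 4≤k (palSuffix i (a ∷ []) _ _ _ en _ un) with early-letter a
  ... | j , j< , xj = ⊥-elim (proj₁ (un j z≤n (≤-trans j< (≤-trans 4≤k (≤-reflexive
                        (sym (suc-injective (trans (+-comm 1 i) en))))))) (xj ∷ []))
  enclosed-only k 4≤k (palSuffix i (a ∷ c ∷ v) _ _ h en ps un) =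
    enclosed-by-ends k i a (c ∷ v) (s≤s z≤n) h en ([ id , id ]′ ps) (λ q q<i → proj₁ (un q z≤n q<i))

  enclosed-any : ∀ k → PalSuffix id x 1 k → EnclosedPal x any k
  enclosed-any k (palSuffix (suc i) v _ _ h en ps un) = enclosedPal i v h en ([ id , id ]′ ps) refl
    (λ q q<i _ g _ → proj₁ (un (suc q) (s≤s z≤n) (s≤s q<i)) g)

  data Adjacent (j : ℕ) : Set where
    block-start : x j ≡ c0 → mem pair (x (suc j)) ≡ true → Adjacent j
    block-end   : mem pair (x j) ≡ true → x (suc j) ≡ c0 → Adjacent j
    double-2    : ∀ k → j ≡ b k + 1 → x k ≡ c1 → x j ≡ c2 → x (suc j) ≡ c2 → Adjacent j

  adjacent : ∀ j → Adjacent j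
  adjacent j with locate j
  ... | k , o , refl , o< = go o (x k) refl o< (At-nth (f-spec k) o (≤-trans o< (≤-trans (n≤1+n _) ln)))
      (trans (cong x (sym (+-suc (b k) o))) (At-nth (f-spec k) (suc o) (≤-trans (s≤s o<) ln)))
    where
    ln : suc (lenF (x k)) ≤ length (fL (x k) ++ c0 ∷ [])
    ln = ≤-reflexive (sym (trans (length-++ (fL (x k))) (+-comm _ 1)))
    pr : ∀ {i a} → x i ≡ a → mem pair a ≡ true → mem pair (x i) ≡ true
    pr e m = trans (cong (mem pair) e) m
    go : ∀ o c → x k ≡ c → o < lenF c → x (b k + o) ≡ nth (fL c ++ c0 ∷ []) o →
         x (suc (b k + o)) ≡ nth (fL c ++ c0 ∷ []) (suc o) → Adjacent (b k + o)
    go 0 c0 _ _ p q = block-start p (pr q refl)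
    go 0 c1 _ _ p q = block-start p (pr q refl)
    go 0 c2 _ _ p q = block-start p (pr q refl)
    go 1 c0 _ _ p q = block-end (pr p refl) q
    go 1 c1 e _ p q = double-2 k refl e p q
    go 1 c2 _ _ p q = block-end (pr p refl) q
    go 2 c1 _ _ p q = block-end (pr p refl) q
    go (suc (suc o)) c0 _ (s≤s (s≤s ()))
    go (suc (suc (suc o))) c1 _ (s≤s (s≤s (s≤s ())))
    go (suc (suc o)) c2 _ (s≤s (s≤s ()))

  b4 : b 4 ≡ 9
  b4 = cong₂ _+_ (cong₂ _+_ (cong₂ _+_ (lx 0) (lx 1)) (lx 2)) (lx 3)
    where
    lx : ∀ i {i< : True (suc i ≤? length X)} → lenF (x i) ≡ lenF (nth X i)
    lx i {i<} = cong lenF (x-nth i (toWitness i<))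

  k≥4 : ∀ {n k} → 10 ≤ n → n < b (suc k) → 4 ≤ k
  k≥4 {n} {k} 10≤n n< = ≮⇒≥ λ k<4 → <⇒≱ n< (≤-trans (b-mono k<4) (≤-trans (≤-reflexive b4) (≤-trans (n≤1+n 9) 10≤n)))

  pal-end : ∀ {q n a v} → At x q (a ∷ v) → q + suc (length v) ≡ suc n → reverse (a ∷ v) ≡ a ∷ v → x n ≡ a
  pal-end {q} h en ps with subst₂ (AtB x) en ps (At⇒AtB h)
  ... | e ∷ _ = e

  -- The palindrome ends, hence begins, with 0, and no 0 follows a 0 in x: its left neighbour, which
  -- exists because the start is at least 1, is in {1,2} automatically.
  enclosed-pair₀ : ∀ n → x n ≡ c0 → PalSuffix id x 1 (suc n) → EnclosedPal x pair (suc n)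
  enclosed-pair₀ n xn (palSuffix (suc i) (a ∷ v) _ _ h@(e ∷ _) en ps un) =
    enclosedPal i (a ∷ v) h en ([ id , id ]′ ps) before
      (λ q q<i _ g _ → proj₁ (un (suc q) (s≤s z≤n) (s≤s q<i)) g)
    where
    xi : x (suc i) ≡ c0
    xi = trans e (trans (sym (pal-end h en ([ id , id ]′ ps))) xn)
    before : mem pair (x i) ≡ true
    before with adjacent i
    ... | block-end m _          = m
    ... | double-2 _ _ _ e _     = cong (mem pair) e
    ... | block-start _ m        with trans (sym m) (cong (mem pair) xi)
    ...   | ()

  pair-pair : ∀ j → mem pair (x j) ≡ true → mem pair (x (suc j)) ≡ true → x j ≡ c2 × x (suc j) ≡ c2
  pair-pair j m m′ with adjacent j
  ... | double-2 _ _ _ e e′ = e , e′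
  ... | block-start e _ with trans (sym m) (cong (mem pair) e)
  ...   | ()
  pair-pair j m m′ | block-end _ e with trans (sym m′) (cong (mem pair) e)
  ...   | ()

  -- Adjacent nonzero letters are 22, so around the empty palindrome, or one with ends 2, enclosure
  -- by {1,2} is the same as enclosure by 2.
  enclosed-pair₂ : ∀ n → x n ≡ c2 → EnclosedPal x (only c2) (suc n) → EnclosedPal x pair (suc n)
  enclosed-pair₂ n xn (enclosedPal i [] h en ps be un) =
    enclosedPal i [] h en ps (cong (mem pair) (sym (mem-only be)))
      (λ q q<i m g m′ → let m″ = subst (λ j → mem pair (x j) ≡ true) (+-identityʳ (suc q)) m′
                            e , e′ = pair-pair q m m″ in
         un q q<i (cong (mem (only c2)) e) g
           (trans (cong (mem (only c2) ∘ x) (+-identityʳ (suc q))) (cong (mem (only c2)) e′)))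
  enclosed-pair₂ n xn (enclosedPal i (a ∷ v) h@(e ∷ _) en ps be un) =
    enclosedPal i (a ∷ v) h en ps (cong (mem pair) (sym (mem-only be))) uniq
    where
    a≡2 : a ≡ c2
    a≡2 = trans (sym (pal-end h en ps)) xn
    uniq : ∀ q → q < i → mem pair (x q) ≡ true → At x (suc q) (a ∷ v) →
           mem pair (x (suc q + suc (length v))) ≡ true → ⊥
    uniq q q<i m g@(e′ ∷ _) m′ = un q q<i
      (cong (mem (only c2)) (proj₁ (pair-pair q m (cong (mem pair) (trans e′ a≡2))))) g
      (cong (mem (only c2)) (trans (cong x eq) (proj₂ (pair-pair l (cong (mem pair) (trans last a≡2))
        (subst (λ j → mem pair (x j) ≡ true) eq m′)))))
      where
      l = suc q + length v
      eq : suc q + suc (length v) ≡ suc l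
      eq = +-suc (suc q) (length v)
      last : x l ≡ a
      last = pal-end g eq ps

  Pals : ℕ → Set
  Pals N = PalSuffix id x 0 N × PalSuffix id x 1 N × (mem pair (x N) ≡ true → EnclosedPal x pair N)

  private
    open Search X
    base₀ : ∀ N → N < 11 → 3 ≤ N → ∃[ i ] i < N × GoodStart id 0 N i
    base₀ = from-yes (palSuffixes? id 0 3 11)
    base₁ : ∀ N → N < 11 → 3 ≤ N → ∃[ i ] i < N × GoodStart id 1 N i
    base₁ = from-yes (palSuffixes? id 1 3 11)
    base₂ : ∀ N → N < 11 → 3 ≤ N → mem pair (nth X N) ≡ true → ∃[ i ] i < N × GoodEnclosure pair N i
    base₂ = from-yes (enclosures? pair 3 11)

  -- At length 1 the claim fails, since nothing nonempty starts after the first letter. Lengths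
  -- below 11 are searched; beyond them the last letter lies in a block of index at least 4, as the
  -- first four blocks have 9 letters, and there `enclosed-only` applies.
  pals : ∀ N → 3 ≤ N → Pals N
  pals = <-rec _ step
    where
    step : ∀ N → (∀ {K} → K < N → 3 ≤ K → Pals K) → 3 ≤ N → Pals N
    step N rec 3≤N with N <? 11
    ... | yes N<11 = goodStart⇒palSuffix x-start (base₀ N N<11 3≤N) ,
                     goodStart⇒palSuffix x-start (base₁ N N<11 3≤N) ,
                     λ m → goodEnclosure⇒enclosedPal x-start N<X
                       (base₂ N N<11 3≤N (subst (λ a → mem pair a ≡ true) (x-nth N N<X) m))
      where
      N<X : N < length X
      N<X = ≤-trans N<11 (toWitness {a? = 11 ≤? length X} _)
    step (suc n) rec _ | no N≮11 with locate n
    ... | k , o , n≡ , o< = go 0 z≤n (λ _ _ → z≤n) (λ _ _ → z≤n) proj₁ ,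
                           pal₁ , pair-case
      where
      n≥10 : 10 ≤ n
      n≥10 = ≤-pred (≮⇒≥ N≮11)
      4≤k : 4 ≤ k
      4≤k = k≥4 n≥10 (≤-trans (≤-reflexive (cong suc n≡)) (+-monoʳ-< (b k) o<))
      k≤n : k ≤ n
      k≤n = ≤-trans (n≤b k) (≤-trans (m≤m+n (b k) o) (≤-reflexive (sym n≡)))
      pk : Pals k
      pk = rec (s≤s k≤n) (≤-trans (n≤1+n 3) 4≤k)
      go : ∀ w → w ≤ 1 → (∀ j → w ≤ j → w ≤ b j) → (∀ j → w ≤ b j → w ≤ j) →
           (Pals k → PalSuffix id x w k) → PalSuffix id x w (suc n)
      go w w≤1 up down sel = lifted⇒palSuffix (inner o n≡ o<)
        where
        inner : ∀ o → n ≡ b k + o → o < lenF (x k) → Lifted w (suc n)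
        -- At offset 0 the prefix of length `suc n` ends with the one-letter marker of block `k`; at
        -- a positive offset it ends that many letters later.
        inner zero    n≡ _  = subst (Lifted w) (trans (+-comm (b k) 1) (cong suc (sym (trans n≡ (+-identityʳ (b k))))))
                                (lift-aligned w k up down (sel pk))
        inner (suc r) n≡ o< = subst (Lifted w) (trans (+-suc (b k) (suc r)) (cong suc (sym n≡)))
                                (lift-inner w k (suc r) w≤1 (s≤s z≤n) o< (enc (x k) (suc r) refl))
          where
          k<n : k < n
          k<n = ≤-trans (s≤s (n≤b k)) (≤-trans (≤-trans (s≤s (m≤m+n (b k) r)) (≤-reflexive (sym (+-suc (b k) r))))
                  (≤-reflexive (sym n≡)))
          psk : PalSuffix id x 0 (suc k)
          psk = proj₁ (rec (s≤s k<n) (s≤s (≤-trans (s≤s (s≤s z≤n)) 4≤k)))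
          enc : ∀ a r → x k ≡ a → EnclosedPal x (kindF a r) k
          enc c0 r             e = subst (λ c → EnclosedPal x (only c) k) e (enclosed-only k 4≤k psk)
          enc c2 r             e = proj₂ (proj₂ pk) (cong (mem pair) e)
          enc c1 0             e = proj₂ (proj₂ pk) (cong (mem pair) e)
          enc c1 1             e = proj₂ (proj₂ pk) (cong (mem pair) e)
          enc c1 (suc (suc r)) e = subst (λ c → EnclosedPal x (only c) k) e (enclosed-only k 4≤k psk)
      down₁ : ∀ j → 1 ≤ b j → 1 ≤ j
      down₁ (suc j) _ = s≤s z≤n
      pal₁ : PalSuffix id x 1 (suc n)
      pal₁ = go 1 ≤-refl (λ j p → ≤-trans p (n≤b j)) down₁ (proj₁ ∘ proj₂)
      pair-case : mem pair (x (suc n)) ≡ true → EnclosedPal x pair (suc n)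
      pair-case m with adjacent n
      ... | block-start e _ = enclosed-pair₀ n e pal₁
      ... | block-end _ e with trans (sym m) (cong (mem pair) e)
      ...   | ()
      -- Enclosure by 2 needs a palindromic suffix at length `suc (suc n)`, beyond the reach of the
      -- induction hypothesis. It is lifted directly from block `k`, where the prefix ends after the
      -- whole image 022.
      pair-case m | double-2 k n≡ xk e e′ = enclosed-pair₂ n e
        (subst (λ c → EnclosedPal x (only c) (suc n)) e′ (enclosed-only (suc n)
          (≤-trans (≤-trans (toWitness {a? = 4 ≤? 10} _) n≥10) (n≤1+n n)) next))
        where
        xk-len : 2 < lenF (x k)
        xk-len = subst (λ a → 2 < lenF a) (sym xk) ≤-refl
        4≤k′ : 4 ≤ k
        4≤k′ = k≥4 n≥10 (≤-trans (≤-reflexive (cong suc n≡)) (+-monoʳ-< (b k) (<-trans (s≤s (s≤s z≤n)) xk-len)))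
        sk<N : suc k < suc n
        sk<N = s≤s (≤-trans (s≤s (n≤b k)) (≤-reflexive (trans (+-comm 1 (b k)) (sym n≡))))
        next : PalSuffix id x 0 (suc (suc n))
        next = lifted⇒palSuffix (subst (Lifted 0) (trans (+-suc (b k) 2) (trans (cong suc (+-suc (b k) 1)) (cong (suc ∘ suc) (sym n≡))))
          (lift-inner 0 k 2 z≤n (s≤s z≤n) xk-len
            (subst (λ a → EnclosedPal x (kindF a 2) k) (sym xk) (subst (λ c → EnclosedPal x (only c) k) xk
              (enclosed-only k 4≤k′ (proj₁ (rec sk<N (s≤s (≤-trans (s≤s (s≤s z≤n)) 4≤k′)))))))))

-- The block code of z and its palindromic suffixes

-- τ(g(a)) read from an even (true) or odd (false) position of y; |g(a)| is odd only for a = 2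
zT : Bool → Letter → Word
zT τ c0 = tauL τ c2 ++ tauL (not τ) c0
zT τ c1 = tauL τ c2 ++ tauL (not τ) c1
zT τ c2 = tauL τ c2

-- Every g(a) begins with 2, so each block begins with AA or CC, and whatever follows begins with
-- 00. The words AA00 and CC00 are palindromes of length 18.
zM : Bool → Word
zM τ = tauL τ c2 ++ c0 ∷ c0 ∷ []

lenZ : Letter → ℕ
lenZ c0 = 19
lenZ c1 = 24
lenZ c2 = 16

-- After AA00 the blocks of 0, 1, 2 continue with 200, 202202001, 202202002, and after CC00 likewise
-- with 1 and 2 exchanged. The third letter singles out 0 and the ninth separates 1 from 2.
kindZ : Letter → ℕ → Kind
kindZ a r = if ⌊ r ≤? 2 ⌋ then any else long a
  where
  long : Letter → Kind
  long c0 = only c0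
  long a  = if ⌊ r ≤? 8 ⌋ then pair else only a

zCode : BlockCode zT zM lenZ 18 kindZ
zCode = record
  { M-rev     = from-yes (∀Bool? λ τ → reverse (zM τ) ≟W zM τ)
  ; M-len     = from-yes (∀Bool? λ τ → length (zM τ) ≟ 18)
  ; m≥1       = s≤s z≤n
  ; T-len     = from-yes (∀Bool? λ τ → ∀Letter? λ a → length (zT τ a) ≟ lenZ a)
  ; len≥1     = from-yes (∀Letter? λ a → 1 ≤? lenZ a)
  ; TM-prefix = from-yes (∀Bool? λ τ → ∀Letter? λ a → take 18 (zTM τ a) ≟W zM τ)
  ; TM-rev    = from-yes (∀Bool? λ τ → ∀Letter? λ a → reverse (zTM τ a) ≟W zTM (nx a τ) a)
  ; TM-sync   = from-yes (∀Bool? λ τ → ∀Bool? λ τ′ → ∀Letter? λ a → P<? a λ o →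
                  1 ≤? o →-dec ¬? (compat (zM τ′) (drop o (zTM τ a)) Bool.≟ true))
  ; TM-inj    = from-yes (∀Bool? λ τ → ∀Bool? λ τ′ → ∀Letter? λ a → ∀Letter? λ c →
                  (compat (zTM τ a) (zTM τ′ c) Bool.≟ true) →-dec (a ≟L c))
  ; kind-self = from-yes (∀Letter? λ a → P<? a λ r → mem (kindZ a r) a Bool.≟ true)
  ; tail-len  = from-yes (∀Bool? λ τ → ∀Letter? λ a → P<? a λ r → length (zt a r τ) ≟ r)
  ; class⁺    = from-yes (∀Bool? λ τ → ∀Letter? λ a → ∀Letter? λ c → P<? a λ r →
                  1 ≤? r →-dec (mem (kindZ a r) c Bool.≟ true) →-dec
                  (take (18 + r) (zTM τ c) ≟W (zM τ ++ zt a r τ)))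
  ; class⁻    = from-yes (∀Bool? λ τ → ∀Bool? λ τ′ → ∀Letter? λ a → ∀Letter? λ c → P<? a λ r →
                  1 ≤? r →-dec (compat (zM τ ++ zt a r τ) (zTM τ′ c) Bool.≟ true) →-dec
                  (mem (kindZ a r) c Bool.≟ true))
  ; class-len = from-yes (∀Letter? λ a → ∀Letter? λ c → P<? a λ r →
                  1 ≤? r →-dec (mem (kindZ a r) c Bool.≟ true) →-dec (suc r ≤? lenZ c))
  }
  where
  zTM : Bool → Letter → Word
  zTM τ a = zT τ a ++ zM (nx a τ)
  zt : Letter → ℕ → Bool → Word
  zt a r τ = take r (drop 18 (zTM τ a))
  P<? : ∀ a {P : ℕ → Set} → (∀ r → Dec (P r)) → Dec (∀ r → r < lenZ a → P r)
  P<? a P? = ∀<? P? (lenZ a)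

tauW-morph : ∀ k w → tauW k (morph gL w) ≡ blocks zT (isEven k) w
tauW-morph k []       = refl
tauW-morph k (c0 ∷ w) = trans (cong (λ v → tauL (isEven k) c2 ++ tauL (not (isEven k)) c0 ++ v)
    (trans (tauW-morph (2 + k) w) (cong (λ τ → blocks zT τ w) (not-involutive (isEven k)))))
  (sym (++-assoc (tauL (isEven k) c2) _ _))
tauW-morph k (c1 ∷ w) = trans (cong (λ v → tauL (isEven k) c2 ++ tauL (not (isEven k)) c1 ++ v)
    (trans (tauW-morph (2 + k) w) (cong (λ τ → blocks zT τ w) (not-involutive (isEven k)))))
  (sym (++-assoc (tauL (isEven k) c2) _ _))
tauW-morph k (c2 ∷ w) = cong (tauL (isEven k) c2 ++_) (tauW-morph (suc k) w)

module Coded (x y z : Seq)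
             (hx : ∀ n → IsPrefixOf (iter n fW (c0 ∷ [])) x)
             (hy : ∀ n → IsPrefixOf (morph gL (pre x n)) y)
             (hz : ∀ n → IsPrefixOf (tauW 0 (pre y n)) z) where

  module X = Fixed x hx

  z-blocks : ∀ n → At z 0 (blocks zT true (sub x 0 n))
  z-blocks n = subst (At z 0)
    (trans (cong (tauW 0) (hy n)) (trans (tauW-morph 0 (pre x n)) (cong (blocks zT true) (factorAt≡sub x 0 n))))
    (prefix⇒At z _ (hz (length (morph gL (pre x n)))))

  z-spec : ∀ k → At z (pos lenZ x k) (BlockCode.TM zCode (sgn x k) (x k))
  z-spec = At-TM zT zM lenZ 18 x z (BlockCode.T-len zCode)
    (from-yes (∀Bool? λ τ → ∀Letter? λ a → ∀Letter? λ c → take 18 (zT τ a ++ zT (nx a τ) c) ≟W zM τ)) z-blocks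

  open Code x z zT zM lenZ 18 kindZ zCode z-spec public
  open BlockCode zCode using (tail; TM)

  swapW : Word → Word
  swapW = map swapL

  swap-T : ∀ τ a → swapW (zT τ a) ≡ zT (not τ) a
  swap-T = from-yes (∀Bool? λ τ → ∀Letter? λ a → swapW (zT τ a) ≟W zT (not τ) a)

  swap-TM : ∀ τ a → swapW (TM τ a) ≡ TM (not τ) a
  swap-TM = from-yes (∀Bool? λ τ → ∀Letter? λ a → swapW (TM τ a) ≟W TM (not τ) a)

  swap-M : ∀ τ → swapW (zM τ) ≡ zM (not τ)
  swap-M = from-yes (∀Bool? λ τ → swapW (zM τ) ≟W zM (not τ))

  nx-not : ∀ a τ → nx a (not τ) ≡ not (nx a τ)
  nx-not c0 τ = refl
  nx-not c1 τ = refl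
  nx-not c2 τ = refl

  swap-img : ∀ E → (∀ τ → swapW (E τ) ≡ E (not τ)) → ∀ s τ → swapW (img E τ s) ≡ img E (not τ) s
  swap-img E hE []      τ = hE τ
  swap-img E hE (a ∷ s) τ = trans (map-++ swapL (zT τ a) _)
    (cong₂ _++_ (swap-T τ a) (trans (swap-img E hE s (nx a τ)) (cong (λ ρ → img E ρ s) (sym (nx-not a τ)))))

  swap-tail : ∀ a r τ → swapW (tail a r τ) ≡ tail a r (not τ)
  swap-tail a r τ = trans (sym (take-map r (drop 18 (TM τ a))))
    (cong (take r) (trans (sym (drop-map 18 (TM τ a))) (cong (drop 18) (swap-TM τ a))))

  swap-wrap : ∀ t → (∀ τ → swapW (t τ) ≡ t (not τ)) → ∀ s τ → swapW (wrap t s τ) ≡ wrap t s (not τ)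
  swap-wrap t ht s τ = trans (map-++ swapL (reverse (t τ)) _)
    (cong₂ _++_ (trans (reverse-map swapL (t τ)) (cong reverse (ht τ)))
      (swap-img _ (λ ρ → trans (map-++ swapL (zM ρ) (t ρ)) (cong₂ _++_ (swap-M ρ) (ht ρ))) s τ))

  lifted⇒palSuffix : ∀ {w N} → Lifted w N → PalSuffix swapW z w N
  lifted⇒palSuffix (lifted q τ t s w≤q ne at en ps fm un) =
    palSuffix q (wrap t s τ) w≤q ne at en (pal (nxs s τ) refl)
      (λ p w≤p p<q → un p w≤p p<q τ , λ h → un p w≤p p<q (not τ) (subst (At z p) (swap-wrap t ht s τ) h))
    where
    ht : ∀ ρ → swapW (t ρ) ≡ t (not ρ)
    ht ρ = [ (λ { refl → refl }) , (λ { (a , r , refl) → swap-tail a r ρ }) ]′ fm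
    either : ∀ ρ τ → ρ ≡ τ ⊎ ρ ≡ not τ
    either true  true  = inj₁ refl
    either false false = inj₁ refl
    either true  false = inj₂ refl
    either false true  = inj₂ refl
    pal : ∀ ρ → nxs s τ ≡ ρ → reverse (wrap t s τ) ≡ wrap t s τ ⊎ reverse (wrap t s τ) ≡ swapW (wrap t s τ)
    pal ρ e with either ρ τ
    ... | inj₁ refl = inj₁ (trans (wrap-reverse t s ps τ) (cong (wrap t s) e))
    ... | inj₂ refl = inj₂ (trans (wrap-reverse t s ps τ) (trans (cong (wrap t s) e) (sym (swap-wrap t ht s τ))))

  Z : Word
  Z = take 96 (blocks zT true (iter 3 fW (c0 ∷ [])))

  z-start : At z 0 Z
  z-start = At-++⁻ˡ Z {drop 96 (blocks zT true w)} (subst (At z 0) (sym (take++drop≡id 96 (blocks zT true w)))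
      (subst (At z 0) (cong (blocks zT true) (At⇒sub≡ (prefix⇒At x w (hx 3)))) (z-blocks (length w))))
    where w = iter 3 fW (c0 ∷ [])

  private
    open Search Z
    base : ∀ N → N < 96 → 1 ≤ N → ∃[ i ] i < N × GoodStart swapW 0 N i
    base = from-yes (palSuffixes? swapW 0 1 96)

  b4 : b 4 ≡ 78
  b4 = cong₂ _+_ (cong₂ _+_ (cong₂ _+_ (lx 0) (lx 1)) (lx 2)) (lx 3)
    where
    lx : ∀ i {i< : True (suc i ≤? length X.X)} → lenZ (x i) ≡ lenZ (nth X.X i)
    lx i {i<} = cong lenZ (X.x-nth i (toWitness i<))

  -- The relevant block contains position N - 18, so that its marker has been read completely. The
  -- search bound is 96 = 78 + 18, where 78 is the length of the first four blocks; from there on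
  -- the block index is at least 4.
  palSuffixes : ∀ N → 1 ≤ N → PalSuffix swapW z 0 N
  palSuffixes N 1≤N with N <? 96
  ... | yes N<96 = goodStart⇒palSuffix z-start (base N N<96 1≤N)
  ... | no N≮96 with locate (N ∸ 18)
  ...   | k , o , eq , o< = lifted⇒palSuffix (inner o eq o<)
    where
    96≤N : 96 ≤ N
    96≤N = ≮⇒≥ N≮96
    N≡ : ∀ {o} → N ∸ 18 ≡ b k + o → b k + (18 + o) ≡ N
    N≡ {o} e = trans (cong (b k +_) (+-comm 18 o)) (trans (sym (+-assoc (b k) o 18))
                 (trans (cong (_+ 18) (sym e)) (m∸n+n≡m (≤-trans (toWitness {a? = 18 ≤? 96} _) 96≤N))))
    4≤k : 4 ≤ k
    4≤k = ≮⇒≥ λ k<4 → <⇒≱ (≤-trans (≤-reflexive (cong suc eq)) (+-monoʳ-< (b k) o<))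
            (≤-trans (b-mono k<4) (≤-trans (≤-reflexive b4) (∸-monoˡ-≤ 18 96≤N)))
    p₀ : PalSuffix id x 0 k
    p₀ = proj₁ (X.pals k (≤-trans (n≤1+n 3) 4≤k))
    p₁ : PalSuffix id x 1 k
    p₁ = proj₁ (proj₂ (X.pals k (≤-trans (n≤1+n 3) 4≤k)))
    p₂ : mem pair (x k) ≡ true → EnclosedPal x pair k
    p₂ = proj₂ (proj₂ (X.pals k (≤-trans (n≤1+n 3) 4≤k)))
    p₃ : EnclosedPal x (only (x k)) k
    p₃ = X.enclosed-only k 4≤k (proj₁ (X.pals (suc k) (≤-trans (≤-trans (n≤1+n 3) 4≤k) (n≤1+n k))))
    enc : ∀ a r → x k ≡ a → EnclosedPal x (kindZ a r) k
    enc a r e with r ≤? 2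
    ... | yes _ = X.enclosed-any k p₁
    enc c0 r e | no _ = subst (λ c → EnclosedPal x (only c) k) e p₃
    enc c1 r e | no _ with r ≤? 8
    ... | yes _ = p₂ (cong (mem pair) e)
    ... | no _  = subst (λ c → EnclosedPal x (only c) k) e p₃
    enc c2 r e | no _ with r ≤? 8
    ... | yes _ = p₂ (cong (mem pair) e)
    ... | no _  = subst (λ c → EnclosedPal x (only c) k) e p₃
    inner : ∀ o → N ∸ 18 ≡ b k + o → o < lenZ (x k) → Lifted 0 N
    inner zero    e _  = subst (Lifted 0) (N≡ e) (lift-aligned 0 k (λ _ _ → z≤n) (λ _ _ → z≤n) p₀)
    inner (suc r) e o< = subst (Lifted 0) (N≡ e) (lift-inner 0 k (suc r) z≤n (s≤s z≤n) o< (enc (x k) (suc r) refl))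

-- The group G and its action on words

data IsMorph : Sym → Set where
  morph-I  : IsMorph I
  morph-RS : IsMorph RS

morph⊎anti : ∀ η → IsMorph η ⊎ IsAnti η
morph⊎anti I  = inj₁ morph-I
morph⊎anti R  = inj₂ anti-R
morph⊎anti S  = inj₂ anti-S
morph⊎anti RS = inj₁ morph-RS

swapL-involutive : ∀ a → swapL (swapL a) ≡ a
swapL-involutive c0 = refl
swapL-involutive c1 = refl
swapL-involutive c2 = refl

map-swap-involutive : ∀ w → map swapL (map swapL w) ≡ w
map-swap-involutive w = trans (sym (map-∘ w)) (trans (map-cong swapL-involutive w) (map-id w))

_∙_ : Sym → Sym → Sym
I  ∙ η  = η
η  ∙ I  = η
R  ∙ R  = I
R  ∙ S  = RS
R  ∙ RS = S
S  ∙ R  = RS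
S  ∙ S  = I
S  ∙ RS = R
RS ∙ R  = S
RS ∙ S  = R
RS ∙ RS = I

act-∙ : ∀ η θ w → act η (act θ w) ≡ act (η ∙ θ) w
act-∙ I  θ  w = refl
act-∙ R  I  w = refl
act-∙ R  R  w = reverse-involutive w
act-∙ R  S  w = reverse-involutive (map swapL w)
act-∙ R  RS w = refl
act-∙ S  I  w = refl
act-∙ S  R  w = trans (cong reverse (reverse-map swapL w)) (reverse-involutive (map swapL w))
act-∙ S  S  w = trans (cong reverse (reverse-map swapL (map swapL w)))
                  (trans (reverse-involutive _) (map-swap-involutive w))
act-∙ S  RS w = cong reverse (map-swap-involutive w)
act-∙ RS I  w = refl
act-∙ RS R  w = reverse-map swapL w
act-∙ RS S  w = trans (reverse-map swapL (map swapL w)) (cong reverse (map-swap-involutive w))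
act-∙ RS RS w = map-swap-involutive w

∙-self : ∀ η → η ∙ η ≡ I
∙-self I  = refl
∙-self R  = refl
∙-self S  = refl
∙-self RS = refl

∙-comm : ∀ η θ → η ∙ θ ≡ θ ∙ η
∙-comm I  I  = refl
∙-comm I  R  = refl
∙-comm I  S  = refl
∙-comm I  RS = refl
∙-comm R  I  = refl
∙-comm R  R  = refl
∙-comm R  S  = refl
∙-comm R  RS = refl
∙-comm S  I  = refl
∙-comm S  R  = refl
∙-comm S  S  = refl
∙-comm S  RS = refl
∙-comm RS I  = refl
∙-comm RS R  = refl
∙-comm RS S  = refl
∙-comm RS RS = refl

act-involutive : ∀ η w → act η (act η w) ≡ w
act-involutive η w = trans (act-∙ η η w) (cong (λ θ → act θ w) (∙-self η))

act-comm : ∀ η θ w → act η (act θ w) ≡ act θ (act η w)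
act-comm η θ w = trans (act-∙ η θ w) (trans (cong (λ ζ → act ζ w) (∙-comm η θ)) (sym (act-∙ θ η w)))

act-length : ∀ η w → length (act η w) ≡ length w
act-length I  w = refl
act-length R  w = length-reverse w
act-length S  w = trans (length-reverse (map swapL w)) (length-map swapL w)
act-length RS w = length-map swapL w

act-++-morph : ∀ {η} → IsMorph η → ∀ v w → act η (v ++ w) ≡ act η v ++ act η w
act-++-morph morph-I  v w = refl
act-++-morph morph-RS v w = map-++ swapL v w

act-++-anti : ∀ {η} → IsAnti η → ∀ v w → act η (v ++ w) ≡ act η w ++ act η v
act-++-anti anti-R v w = reverse-++ v w
act-++-anti anti-S v w = trans (cong reverse (map-++ swapL v w)) (reverse-++ (map swapL v) (map swapL w))

~-refl : ∀ {w} → w ~ w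
~-refl = I , refl

~-sym : ∀ {v w} → v ~ w → w ~ v
~-sym {v} (η , refl) = η , act-involutive η v

~-trans : ∀ {u v w} → u ~ v → v ~ w → u ~ w
~-trans {u} (η , refl) (θ , refl) = θ ∙ η , sym (act-∙ θ η u)

_~?_ : ∀ v w → Dec (v ~ w)
v ~? w = map′ to from ((act I v ≟W w) ⊎-dec (act R v ≟W w) ⊎-dec (act S v ≟W w) ⊎-dec (act RS v ≟W w))
  where
  to : act I v ≡ w ⊎ act R v ≡ w ⊎ act S v ≡ w ⊎ act RS v ≡ w → v ~ w
  to (inj₁ e)               = I , e
  to (inj₂ (inj₁ e))        = R , e
  to (inj₂ (inj₂ (inj₁ e))) = S , e
  to (inj₂ (inj₂ (inj₂ e))) = RS , e
  from : v ~ w → act I v ≡ w ⊎ act R v ≡ w ⊎ act S v ≡ w ⊎ act RS v ≡ w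
  from (I  , e) = inj₁ e
  from (R  , e) = inj₂ (inj₁ e)
  from (S  , e) = inj₂ (inj₂ (inj₁ e))
  from (RS , e) = inj₂ (inj₂ (inj₂ e))

++-injective : ∀ (v v′ : Word) {w w′} → length v ≡ length v′ → v ++ w ≡ v′ ++ w′ → v ≡ v′ × w ≡ w′
++-injective []      []        _ e = refl , e
++-injective (a ∷ v) (a′ ∷ v′) l e with ∷-injective e
... | refl , e′ with ++-injective v v′ (suc-injective l) e′
...   | refl , e″ = refl , e″

-- Return words of classes

module Returns (z : Seq) where

  F : ℕ → ℕ → Word
  F = sub z

  act-sub-morph : ∀ {η} → IsMorph η → ∀ a b c m d → act η (F a (c + (m + d))) ≡ F b (c + (m + d)) →
                  act η (F (a + c) m) ≡ F (b + c) m
  act-sub-morph {η} mo a b c m d e = proj₁ (++-injective (act η (F (a + c) m)) (F (b + c) m) (len (a + c) (b + c) m)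
      (proj₂ (++-injective (act η (F a c)) (F b c) (len a b c) (trans (sym (split a)) (trans e (split′ b))))))
    where
    len : ∀ a b m → length (act η (F a m)) ≡ length (F b m)
    len a b m = trans (act-length η (F a m)) (trans (sub-length z a m) (sym (sub-length z b m)))
    split′ : ∀ a → F a (c + (m + d)) ≡ F a c ++ F (a + c) m ++ F (a + c + m) d
    split′ a = trans (sub-++ z a c (m + d)) (cong (F a c ++_) (sub-++ z (a + c) m d))
    split : ∀ a → act η (F a (c + (m + d))) ≡ act η (F a c) ++ act η (F (a + c) m) ++ act η (F (a + c + m) d)
    split a = trans (cong (act η) (split′ a)) (trans (act-++-morph mo (F a c) _)
                (cong (act η (F a c) ++_) (act-++-morph mo (F (a + c) m) _)))

  -- An antimorphism exchanges the margins `c` and `d` around the window.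
  act-sub-anti : ∀ {η} → IsAnti η → ∀ a b c m d → act η (F a (c + (m + d))) ≡ F b (c + (m + d)) →
                 act η (F (a + c) m) ≡ F (b + d) m
  act-sub-anti {η} an a b c m d e = proj₁ (++-injective (act η (F (a + c) m)) (F (b + d) m) (len (a + c) (b + d) m)
      (proj₂ (++-injective (act η (F (a + c + m) d)) (F b d) (len (a + c + m) b d) (trans (sym split) (trans e split′)))))
    where
    len : ∀ a b m → length (act η (F a m)) ≡ length (F b m)
    len a b m = trans (act-length η (F a m)) (trans (sub-length z a m) (sym (sub-length z b m)))
    swap : ∀ c m d → c + (m + d) ≡ d + (m + c)
    swap = solve-∀
    split′ : F b (c + (m + d)) ≡ F b d ++ F (b + d) m ++ F (b + d + m) c
    split′ = trans (cong (F b) (swap c m d))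
               (trans (sub-++ z b d (m + c)) (cong (F b d ++_) (sub-++ z (b + d) m c)))
    split : act η (F a (c + (m + d))) ≡ act η (F (a + c + m) d) ++ act η (F (a + c) m) ++ act η (F a c)
    split = trans (cong (act η) (trans (sub-++ z a c (m + d)) (cong (F a c ++_) (sub-++ z (a + c) m d))))
              (trans (act-++-anti an (F a c) _)
                (trans (cong (_++ act η (F a c)) (act-++-anti an (F (a + c) m) _))
                  (++-assoc (act η (F (a + c + m) d)) _ _)))

  Fixed : ℕ → ℕ → Set
  Fixed p n = ∃[ Θ ] IsAnti Θ × act Θ (F p n) ≡ F p n

  Return : ℕ → ℕ → ℕ → Set
  Return n p d = F p n ~ F (p + d) n × (∀ e → 0 < e → e < d → ¬ F p n ~ F (p + e) n)

  module WithPals (palSuffixes : ∀ N → 1 ≤ N → PalSuffix (map swapL) z 0 N) where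

    record GPalSuffix (N : ℕ) : Set where
      constructor gpalSuffix
      field
        i L    : ℕ
        ends   : i + L ≡ N
        fixed  : Fixed i L
        unique : ∀ q → q < i → ¬ F i L ~ F q L

    -- A word fixed by R or S has only itself and its letter exchange in its class, so newness of
    -- these two is newness of the class.
    gpalSuffixes : ∀ N → 1 ≤ N → GPalSuffix N
    gpalSuffixes N 1≤N with palSuffixes N 1≤N
    ... | palSuffix i V _ _ h en ps un with At⇒sub≡ h
    ...   | eq = gpalSuffix i (length V) en (fixed ps)
                   (λ q q<i r → uniq q q<i (subst (_~ F q (length V)) eq r))
      where
      fixed : reverse V ≡ V ⊎ reverse V ≡ map swapL V → Fixed i (length V)
      fixed (inj₁ e) = R , anti-R , trans (cong reverse eq) (trans e (sym eq))
      fixed (inj₂ e) = S , anti-S , trans (cong (act S) eq)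
        (trans (sym (reverse-map swapL V)) (trans (cong (map swapL) e) (trans (map-swap-involutive V) (sym eq))))
      orbit : ∀ η → act η V ≡ V ⊎ act η V ≡ map swapL V
      orbit I  = inj₁ refl
      orbit RS = inj₂ refl
      orbit R  = ps
      orbit S  = [ (λ e → inj₂ (trans (sym (reverse-map swapL V)) (cong (map swapL) e))) ,
                   (λ e → inj₁ (trans (sym (reverse-map swapL V)) (trans (cong (map swapL) e) (map-swap-involutive V)))) ]′ ps
      uniq : ∀ q → q < i → ¬ V ~ F q (length V)
      uniq q q<i (η , r) with orbit η
      ... | inj₁ e = proj₁ (un q z≤n q<i) (subst (At z q) (trans (sym r) e) (At-sub q (length V)))
      ... | inj₂ e = proj₂ (un q z≤n q<i) (subst (At z q) (trans (sym r) e) (At-sub q (length V)))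

    -- A palindromic suffix of z[0, p+d+n) that is new there either is the return word itself, or is
    -- longer and reflects it onto an earlier return word; shorter ones would have occurred before.
    return-fixed : ∀ n → 1 ≤ n → ∀ p d → 0 < d → Return n p d → Fixed p (d + n)
    return-fixed n 1≤n = <-rec _ step
      where
      step : ∀ p → (∀ {i} → i < p → ∀ d → 0 < d → Return n i d → Fixed i (d + n)) →
             ∀ d → 0 < d → Return n p d → Fixed p (d + n)
      step p rec d 0<d (rt , int) with gpalSuffixes (p + (d + n)) (≤-trans 1≤n (≤-trans (m≤n+m n d) (m≤n+m (d + n) p)))
      ... | gpalSuffix i L en (Θ , anti , fx) un with <-cmp i p
      ...   | tri≈ _ refl _ = Θ , anti , subst (λ m → act Θ (F i m) ≡ F i m) (+-cancelˡ-≡ i _ _ en) fx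
      ...   | tri> _ _ p<i with m≤n⇒∃[o]m+o≡n (<⇒≤ p<i)
      ...     | c , refl with <-cmp c d
      ...       | tri< c<d _ _ with m≤n⇒∃[o]m+o≡n (<⇒≤ c<d)
      -- `Θ` reflects the last window, at p + d, to the beginning p + c of the suffix, which would
      -- be an inner visit of the class.
      ...         | e , refl = ⊥-elim (int c (+-cancelˡ-< p 0 c (≤-trans (≤-reflexive (cong suc (+-identityʳ p))) p<i)) c<d
                      (~-trans rt (Θ , subst₂ (λ a b → act Θ (F a n) ≡ F b n) (+-assoc p c e) (+-identityʳ (p + c))
                        (act-sub-anti anti (p + c) (p + c) e n 0 (subst (λ m → act Θ (F (p + c) m) ≡ F (p + c) m) L≡ fx)))))
        where
        L≡ : L ≡ e + (n + 0)
        L≡ = +-cancelˡ-≡ (p + c) _ _ (trans en (arith p c e n))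
          where
          arith : ∀ p c e n → p + (c + e + n) ≡ p + c + (e + (n + 0))
          arith = solve-∀
      step p rec d 0<d (rt , int) | gpalSuffix _ L en (Θ , anti , fx) un | tri> _ _ p<i | c , refl | tri≈ _ refl _ =
        ⊥-elim (un p p<i (subst (λ m → F (p + c) m ~ F p m) L≡ (~-sym rt)))
        where
        L≡ : n ≡ L
        L≡ = +-cancelˡ-≡ (p + c) _ _ (trans (+-assoc p c n) (sym en))
      step p rec d 0<d ((η , rt) , int) | gpalSuffix _ L en (Θ , anti , fx) un | tri> _ _ p<i | c , refl | tri> _ _ d<c
        with m≤n⇒∃[o]m+o≡n (<⇒≤ d<c)
      -- The suffix lies inside the last window; `η` carries it into the first one, to p + g or to
      -- p, hence to an earlier place.
      ... | g , refl = ⊥-elim ([ (λ mo → un (p + g) (+-monoʳ-< p (+-monoˡ-< g 0<d)) (η , back (act-sub-morph mo (p + d) p g L 0 rt′))) ,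
                                 (λ an → un p p<i (η , subst (λ a → act η (F (p + (d + g)) L) ≡ F a L) (+-identityʳ p) (back (act-sub-anti an (p + d) p g L 0 rt′)))) ]′
                               (morph⊎anti η))
        where
        n≡ : n ≡ g + (L + 0)
        n≡ = +-cancelˡ-≡ (p + d) _ _ (trans (+-assoc p d n) (trans (sym en) (arith p d g L)))
          where
          arith : ∀ p d g L → p + (d + g) + L ≡ p + d + (g + (L + 0))
          arith = solve-∀
        rt′ : act η (F (p + d) (g + (L + 0))) ≡ F p (g + (L + 0))
        rt′ = subst (λ m → act η (F (p + d) m) ≡ F p m) n≡ (trans (cong (act η) (sym rt)) (act-involutive η (F p n)))
        back : ∀ {w} → act η (F (p + d + g) L) ≡ w → act η (F (p + (d + g)) L) ≡ w
        back = trans (cong (λ a → act η (F a L)) (sym (+-assoc p d g)))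
      step p rec d 0<d (rt , int) | gpalSuffix i L en (Θ , anti , fx) un | tri< i<p _ _ with m≤n⇒∃[o]m+o≡n (<⇒≤ i<p)
      -- `Θ` reflects the word at p onto the word at i, again a return word. As G is commutative,
      -- the antimorphism that fixes the reflected word fixes the original.
      ... | c , refl = result (rec i<p d 0<d (rt′ , int′))
        where
        L≡ : L ≡ c + (d + n + 0)
        L≡ = +-cancelˡ-≡ i _ _ (trans en (arith i c d n))
          where
          arith : ∀ i c d n → i + c + (d + n) ≡ i + (c + (d + n + 0))
          arith = solve-∀
        mirror : act Θ (F (i + c) (d + n)) ≡ F i (d + n)
        mirror = subst (λ a → act Θ (F (i + c) (d + n)) ≡ F a (d + n)) (+-identityʳ i)
          (act-sub-anti anti i i c (d + n) 0 (subst (λ m → act Θ (F i m) ≡ F i m) L≡ fx))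
        at : ∀ e e′ → e + e′ ≡ d → act Θ (F (i + c + e) n) ≡ F (i + e′) n
        at e e′ refl = act-sub-anti anti (i + c) i e n e′
          (subst (λ m → act Θ (F (i + c) m) ≡ F i m) (arith e e′ n) mirror)
          where
          arith : ∀ e e′ n → e + e′ + n ≡ e + (n + e′)
          arith = solve-∀
        start : F (i + c) n ~ F (i + d) n
        start = Θ , trans (cong (λ a → act Θ (F a n)) (sym (+-identityʳ (i + c)))) (at 0 d refl)
        stop : F (i + c + d) n ~ F i n
        stop = Θ , trans (at d 0 (+-identityʳ d)) (cong (λ a → F a n) (+-identityʳ i))
        rt′ : F i n ~ F (i + d) n
        rt′ = ~-trans (~-sym stop) (~-trans (~-sym rt) start)
        int′ : ∀ e → 0 < e → e < d → ¬ F i n ~ F (i + e) n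
        int′ e 0<e e<d r with m≤n⇒∃[o]m+o≡n (<⇒≤ e<d)
        ... | e′ , refl = int e′ (+-cancelˡ-< e 0 e′ (≤-trans (≤-reflexive (cong suc (+-identityʳ e))) e<d))
                (≤-trans (+-monoˡ-< e′ 0<e) ≤-refl)
                (~-trans rt (~-trans stop (~-trans r (~-sym (Θ , at e′ e (+-comm e′ e))))))
        result : Fixed i (d + n) → Fixed (i + c) (d + n)
        result (Θ′ , anti′ , fx′) = Θ′ , anti′ , (begin
          act Θ′ X                     ≡⟨ sym (act-involutive Θ _) ⟩
          act Θ (act Θ (act Θ′ X))     ≡⟨ cong (act Θ) (act-comm Θ Θ′ X) ⟩
          act Θ (act Θ′ (act Θ X))     ≡⟨ cong (act Θ ∘ act Θ′) mirror ⟩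
          act Θ (act Θ′ (F i (d + n))) ≡⟨ cong (act Θ) fx′ ⟩
          act Θ (F i (d + n))          ≡⟨ cong (act Θ) (sym mirror) ⟩
          act Θ (act Θ X)              ≡⟨ act-involutive Θ X ⟩
          X ∎)
          where
          X = F (i + c) (d + n)
          open ≡-Reasoning

-- Graphs of symmetries

swapL-injective : ∀ {a b} → swapL a ≡ swapL b → a ≡ b
swapL-injective {a} {b} e = trans (sym (swapL-involutive a)) (trans (cong swapL e) (swapL-involutive b))

parity : (ℕ → Bool) → ℕ → Bool
parity h zero    = false
parity h (suc n) = h n xor parity h n

parity-shift : ∀ h n → parity h (suc n) ≡ parity (h ∘ suc) n xor h 0
parity-shift h zero    = xor-comm (h 0) false
parity-shift h (suc n) = trans (cong (h (suc n) xor_) (parity-shift h n)) (sym (xor-assoc (h (suc n)) _ _))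

-- Mirror indices cancel in pairs, and the centre, if there is one, contributes `false`.
parity-symmetric : ∀ h n → (∀ a b → a + suc b ≡ n → h a ≡ h b) → (∀ a → a + suc a ≡ n → h a ≡ false) →
                   parity h n ≡ false
parity-symmetric h zero          sy ce = refl
parity-symmetric h (suc zero)    sy ce = cong (_xor false) (ce 0 refl)
parity-symmetric h (suc (suc n)) sy ce = begin
  h (suc n) xor parity h (suc n)                    ≡⟨ cong (h (suc n) xor_) (parity-shift h n) ⟩
  h (suc n) xor (parity (h ∘ suc) n xor h 0)        ≡⟨ cong (λ p → h (suc n) xor (p xor h 0)) inner ⟩
  h (suc n) xor h 0                                 ≡⟨ cong (h (suc n) xor_) (sy 0 (suc n) refl) ⟩
  h (suc n) xor h (suc n)                           ≡⟨ xor-same (h (suc n)) ⟩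
  false ∎
  where
  open ≡-Reasoning
  inner : parity (h ∘ suc) n ≡ false
  inner = parity-symmetric (h ∘ suc) n
    (λ a b e → sy (suc a) (suc b) (cong suc (trans (+-suc a (suc b)) (cong suc e))))
    (λ a e → ce (suc a) (cong suc (trans (+-suc a (suc a)) (cong suc e))))

parity-false : ∀ h n → (∀ j → j < n → h j ≡ false) → parity h n ≡ false
parity-false h zero    hf = refl
parity-false h (suc n) hf = trans (cong (_xor parity h n) (hf n ≤-refl))
                                  (parity-false h n (λ j j<n → hf j (<-trans j<n ≤-refl)))

module Graph (z : Seq) (closed : Closed z)
             (return-fixed : ∀ n → 1 ≤ n → ∀ p d → 0 < d → Returns.Return z n p d → Returns.Fixed z p (d + n))
             where

  open Returns z

  special-R : ∀ {w} → Special z w → Special z (reverse w)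
  special-R {w} (inj₁ (a , b , a≢b , f , g)) = inj₂ (a , b , a≢b ,
    subst (Factor z) (unfold-reverse a w) (closed R _ f) , subst (Factor z) (unfold-reverse b w) (closed R _ g))
  special-R {w} (inj₂ (a , b , a≢b , f , g)) = inj₁ (a , b , a≢b ,
    subst (Factor z) (reverse-++ w (a ∷ [])) (closed R _ f) , subst (Factor z) (reverse-++ w (b ∷ [])) (closed R _ g))

  special-RS : ∀ {w} → Special z w → Special z (map swapL w)
  special-RS {w} (inj₁ (a , b , a≢b , f , g)) =
    inj₁ (swapL a , swapL b , a≢b ∘ swapL-injective , closed RS _ f , closed RS _ g)
  special-RS {w} (inj₂ (a , b , a≢b , f , g)) = inj₂ (swapL a , swapL b , a≢b ∘ swapL-injective ,
    subst (Factor z) (map-++ swapL w (a ∷ [])) (closed RS _ f) , subst (Factor z) (map-++ swapL w (b ∷ [])) (closed RS _ g))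

  special-act : ∀ η {w} → Special z w → Special z (act η w)
  special-act I  s = s
  special-act R  s = special-R s
  special-act RS s = special-RS s
  special-act S  s = special-R (special-RS s)

  special-~ : ∀ {v w} → Special z v → v ~ w → Special z w
  special-~ s (η , refl) = special-act η s

  factor-sub : ∀ p n → Factor z (F p n)
  factor-sub p n = p , trans (factorAt≡sub z p _) (cong (F p) (sub-length z p n))

  factor⇒sub : ∀ {w} → (f : Factor z w) → F (proj₁ f) (length w) ≡ w
  factor⇒sub {w} (i , e) = trans (sym (factorAt≡sub z i (length w))) e

  take-sub : ∀ n m p → take n (F p (n + m)) ≡ F p n
  take-sub zero    m p = refl
  take-sub (suc n) m p = cong (z p ∷_) (take-sub n m (suc p))

  drop-sub : ∀ k m p → drop k (F p (k + m)) ≡ F (p + k) m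
  drop-sub zero    m p = cong (λ q → F q m) (sym (+-identityʳ p))
  drop-sub (suc k) m p = trans (drop-sub k m (suc p)) (cong (λ q → F q m) (sym (+-suc p k)))

  record Edge (n p d : ℕ) : Set where
    constructor edge
    field
      0<d   : 0 < d
      first : Special z (F p n)
      last  : Special z (F (p + d) n)
      inner : ∀ k → 0 < k → k < d → ¬ Special z (F (p + k) n)

  take-prefix-sub : ∀ n p d → take n (F p (d + n)) ≡ F p n
  take-prefix-sub n p d = trans (cong (λ m → take n (F p m)) (+-comm d n)) (take-sub n d p)

  suffix-sub : ∀ n p d → suffixN n (F p (d + n)) ≡ F (p + d) n
  suffix-sub n p d = trans
    (cong (λ k → drop k (F p (d + n))) (trans (cong (_∸ n) (sub-length z p (d + n))) (m+n∸n≡m d n)))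
    (drop-sub d n p)

  window-sub : ∀ n p d k → k ≤ d → take n (drop k (F p (d + n))) ≡ F (p + k) n
  window-sub n p d k k≤d with m≤n⇒∃[o]m+o≡n k≤d
  ... | o , refl = trans (cong (λ m → take n (drop k (F p m))) (+-assoc k o n))
                     (trans (cong (take n) (drop-sub k (o + n) p)) (take-prefix-sub n (p + k) o))

  isEdge⇒edge : ∀ {n e} → IsEdge z n e → ∃₂ λ p d → e ≡ F p (d + n) × Edge n p d
  isEdge⇒edge {n} {e} (f@(p , _) , n<e , s , s′ , int) with m≤n⇒∃[o]m+o≡n n<e
  ... | o , eq = p , suc o , e≡ , edge (s≤s z≤n)
        (subst (Special z) (trans (cong (take n) e≡) (take-prefix-sub n p (suc o))) s)
        (subst (Special z) (trans (cong (suffixN n) e≡) (suffix-sub n p (suc o))) s′)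
        (λ k 0<k k<d sp → int k 0<k (≤-trans k<d (≤-reflexive (sym len∸)))
          (subst (Special z) (sym (trans (cong (λ w → take n (drop k w)) e≡) (window-sub n p (suc o) k (<⇒≤ k<d)))) sp))
    where
    len : length e ≡ suc o + n
    len = trans (sym eq) (cong suc (+-comm n o))
    e≡ : e ≡ F p (suc o + n)
    e≡ = trans (sym (factor⇒sub f)) (cong (F p) len)
    len∸ : length e ∸ n ≡ suc o
    len∸ = trans (cong (_∸ n) len) (m+n∸n≡m (suc o) n)

  edge⇒isEdge : ∀ {n p d} → Edge n p d → IsEdge z n (F p (d + n))
  edge⇒isEdge {n} {p} {d} (edge 0<d s s′ int) =
    factor-sub p (d + n) ,
    ≤-trans (+-monoˡ-< n 0<d) (≤-reflexive (sym (sub-length z p (d + n)))) ,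
    subst (Special z) (sym (take-prefix-sub n p d)) s ,
    subst (Special z) (sym (suffix-sub n p d)) s′ ,
    λ k 0<k k< sp → let k<d = ≤-trans k< (≤-reflexive (trans (cong (_∸ n) (sub-length z p (d + n))) (m+n∸n≡m d n))) in
      int k 0<k k<d (subst (Special z) (window-sub n p d k (<⇒≤ k<d)) sp)

  edge-return : ∀ {n p d} → Edge n p d → F p n ~ F (p + d) n → Return n p d
  edge-return (edge 0<d s _ int) r = r , λ k 0<k k<d r′ → int k 0<k k<d (special-~ s r′)

  loopsPal : ∀ n → 1 ≤ n → LoopsPal z n
  loopsPal n 1≤n e ie loop with isEdge⇒edge ie
  ... | p , d , refl , ed = return-fixed n 1≤n p d (Edge.0<d ed)
        (edge-return ed (subst₂ _~_ (take-prefix-sub n p d) (suffix-sub n p d) loop))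

  act-window : ∀ {η} a b d n e e′ → act η (F a (d + n)) ≡ F b (d + n) → e + e′ ≡ d →
               (IsMorph η × act η (F (a + e) n) ≡ F (b + e) n) ⊎ (IsAnti η × act η (F (a + e) n) ≡ F (b + e′) n)
  act-window {η} a b d n e e′ h refl = [ (λ mo → inj₁ (mo , act-sub-morph mo a b e n e′ h′)) ,
                                         (λ an → inj₂ (an , act-sub-anti an a b e n e′ h′)) ]′ (morph⊎anti η)
    where
    arith : ∀ e e′ n → e + e′ + n ≡ e + (n + e′)
    arith = solve-∀
    h′ : act η (F a (e + (n + e′))) ≡ F b (e + (n + e′))
    h′ = subst (λ m → act η (F a m) ≡ F b m) (arith e e′ n) h

  at-0 : ∀ {p n} → F (p + 0) n ≡ F p n
  at-0 {p} {n} = cong (λ q → F q n) (+-identityʳ p)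

  ends-~ : ∀ {a b d n} → F a (d + n) ~ F b (d + n) →
           (F a n ~ F b n × F (a + d) n ~ F (b + d) n) ⊎ (F a n ~ F (b + d) n × F (a + d) n ~ F b n)
  ends-~ {a} {b} {d} {n} (η , h) with act-window {η} a b d n 0 d h refl | act-window {η} a b d n d 0 h (+-identityʳ d)
  ... | inj₁ (_ , e) | inj₁ (_ , e′) = inj₁ ((η , subst₂ (λ v w → act η v ≡ w) at-0 at-0 e) , (η , e′))
  ... | inj₂ (_ , e) | inj₂ (_ , e′) = inj₂ ((η , subst (λ v → act η v ≡ F (b + d) n) at-0 e) ,
                                             (η , trans e′ at-0))
  ... | inj₁ (morph-I , _)  | inj₂ (() , _)
  ... | inj₁ (morph-RS , _) | inj₂ (() , _)
  ... | inj₂ (() , _) | inj₁ (morph-I , _)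
  ... | inj₂ (() , _) | inj₁ (morph-RS , _)

  edge-~ : ∀ {n a d} b → Edge n a d → F a (d + n) ~ F b (d + n) → Edge n b d
  edge-~ {n} {a} {d} b (edge 0<d s s′ int) r@(η , h) = edge 0<d
    ([ (λ e → special-~ s (proj₁ e)) , (λ e → special-~ s′ (proj₂ e)) ]′ (ends-~ r))
    ([ (λ e → special-~ s′ (proj₂ e)) , (λ e → special-~ s (proj₁ e)) ]′ (ends-~ r))
    inner′
    where
    inner′ : ∀ k → 0 < k → k < d → ¬ Special z (F (b + k) n)
    inner′ k 0<k k<d sp with m≤n⇒∃[o]m+o≡n (<⇒≤ k<d)
    ... | o , eq = [ (λ (_ , e) → int k 0<k k<d (special-~ sp (η , e))) ,
                     (λ (_ , e) → int o 0<o o<d (special-~ sp (η , e))) ]′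
                   (act-window {η} b a d n k o (trans (cong (act η) (sym h)) (act-involutive η _)) eq)
      where
      0<o : 0 < o
      0<o = +-cancelˡ-< k 0 o (≤-trans (≤-reflexive (cong suc (+-identityʳ k))) (≤-trans k<d (≤-reflexive (sym eq))))
      o<d : o < d
      o<d = ≤-trans (+-monoˡ-< o 0<k) (≤-reflexive eq)

  module Crossings (n : ℕ) (1≤n : 1 ≤ n) (p₀ d : ℕ) (ed : Edge n p₀ d)
                   (noLoop : ¬ F p₀ n ~ F (p₀ + d) n) where

    E : Word
    E = F p₀ (d + n)

    0<d : 0 < d
    0<d = Edge.0<d ed

    -- an occurrence of the class of E whose last window of length n starts at q
    Arrival : ℕ → Set
    Arrival q = d ≤ q × E ~ F (q ∸ d) (d + n)

    arrival? : ∀ q → Dec (Arrival q)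
    arrival? q = d ≤? q ×-dec (E ~? F (q ∸ d) (d + n))

    arrival⁻ : ∀ {q} → Arrival q → ∃[ a ] a + d ≡ q × E ~ F a (d + n)
    arrival⁻ {q} (d≤q , r) = q ∸ d , m∸n+n≡m d≤q , r

    arrival⁺ : ∀ a → E ~ F a (d + n) → Arrival (a + d)
    arrival⁺ a r = m≤n+m d a , subst (λ b → E ~ F b (d + n)) (sym (m+n∸n≡m a d)) r

    -- the parity of the number of crossings of E before position q: the component of Γₙ − [E] containing it
    side : ℕ → Bool
    side zero    = false
    side (suc q) = does (arrival? (suc q)) xor side q

    side-+ : ∀ q g → side (q + g) ≡ parity (λ j → does (arrival? (suc (q + j)))) g xor side q
    side-+ q zero    = cong side (+-identityʳ q)
    side-+ q (suc g) = trans (cong side (+-suc q g))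
      (trans (cong (does (arrival? (suc (q + g))) xor_) (side-+ q g)) (sym (xor-assoc (does (arrival? (suc (q + g)))) _ _)))

    side-const : ∀ q g → (∀ j → j < g → ¬ Arrival (suc (q + j))) → side (q + g) ≡ side q
    side-const q g h = trans (side-+ q g)
      (cong (_xor side q) (parity-false _ g (λ j j<g → dec-false (arrival? _) (h j j<g))))

    occ-edge : ∀ {a} → E ~ F a (d + n) → Edge n a d
    occ-edge {a} = edge-~ a ed

    -- a special window at p cannot lie strictly inside an occurrence of E
    start-≥ : ∀ {p a} → Special z (F p n) → E ~ F a (d + n) → p < a + d → p ≤ a
    start-≥ {p} {a} sp r p< with p ≤? a
    ... | yes p≤a = p≤a
    ... | no p≰a with m≤n⇒∃[o]m+o≡n (<⇒≤ (≰⇒> p≰a))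
    ...   | k , refl = ⊥-elim (Edge.inner (occ-edge r) k
              (+-cancelˡ-< a 0 k (≤-trans (≤-reflexive (cong suc (+-identityʳ a))) (≰⇒> p≰a)))
              (+-cancelˡ-< a k d p<) sp)

    -- The return word is fixed by an antimorphism, which pairs the crossings of [E] inside it; none
    -- is its own mirror image, as E is no loop. If `g` is less than `d`, no crossing fits.
    side-return : ∀ p g → Special z (F p n) → 0 < g → Return n p g → side (p + g) ≡ side p
    side-return p g sp 0<g rt with d ≤? g
    ... | no d≰g = side-const p g λ j j<g ar → early j (≤-trans (s≤s j<g) (≰⇒> d≰g)) ar
      where
      early : ∀ j → suc j < d → ¬ Arrival (suc (p + j))
      early j sj<d ar with arrival⁻ ar
      ... | a , eq , r = <⇒≱ sj<d (+-cancelˡ-≤ p d (suc j) (≤-trans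
              (+-monoˡ-≤ d (start-≥ sp r (≤-trans (s≤s (m≤m+n p j)) (≤-reflexive (sym eq)))))
              (≤-reflexive (trans eq (sym (+-suc p j))))))
    ... | yes d≤g with m≤n⇒∃[o]m+o≡n d≤g | Edge.0<d ed
    ...   | m , refl | s≤s {n = d′} z≤n = begin
        side (p + (suc d′ + m))              ≡⟨ cong side (arith p d′ m) ⟩
        side (p + d′ + suc m)                ≡⟨ side-+ (p + d′) (suc m) ⟩
        parity h (suc m) xor side (p + d′)   ≡⟨ cong₂ _xor_ even (side-const p d′ early) ⟩
        side p                               ∎
      where
      open ≡-Reasoning
      arith : ∀ p d′ m → p + (suc d′ + m) ≡ p + d′ + suc m
      arith = solve-∀
      -- `h j` records a crossing that begins at p + j; crossings beginning before p are excluded by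
      -- `start-≥`.
      h : ℕ → Bool
      h j = does (arrival? (suc (p + d′ + j)))
      early : ∀ j → j < d′ → ¬ Arrival (suc (p + j))
      early j j<d′ ar with arrival⁻ ar
      ... | a , eq , r = <⇒≱ (s≤s j<d′) (+-cancelˡ-≤ p (suc d′) (suc j) (≤-trans
              (+-monoˡ-≤ (suc d′) (start-≥ sp r (≤-trans (s≤s (m≤m+n p j)) (≤-reflexive (sym eq)))))
              (≤-reflexive (trans eq (sym (+-suc p j))))))
      place : ∀ a → p + a + suc d′ ≡ suc (p + d′ + a)
      place a = arith′ p a d′
        where
        arith′ : ∀ p a d′ → p + a + suc d′ ≡ suc (p + d′ + a)
        arith′ = solve-∀
      occ⁻ : ∀ {a} → Arrival (suc (p + d′ + a)) → E ~ F (p + a) (suc d′ + n)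
      occ⁻ {a} ar with arrival⁻ ar
      ... | b , eq , r = subst (λ q → E ~ F q (suc d′ + n)) (+-cancelʳ-≡ (suc d′) b (p + a) (trans eq (sym (place a)))) r
      occ⁺ : ∀ {a} → E ~ F (p + a) (suc d′ + n) → Arrival (suc (p + d′ + a))
      occ⁺ {a} r = subst Arrival (place a) (arrival⁺ (p + a) r)
      Θ = proj₁ (return-fixed n 1≤n p (suc d′ + m) 0<g rt)
      anti = proj₁ (proj₂ (return-fixed n 1≤n p (suc d′ + m) 0<g rt))
      fx = proj₂ (proj₂ (return-fixed n 1≤n p (suc d′ + m) 0<g rt))
      mirror : ∀ a b → a + suc b ≡ suc m → act Θ (F (p + a) (suc d′ + n)) ≡ F (p + b) (suc d′ + n)
      mirror a b e = act-sub-anti anti p p a (suc d′ + n) b (subst (λ l → act Θ (F p l) ≡ F p l) len fx)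
        where
        m≡ : m ≡ a + b
        m≡ = suc-injective (trans (sym e) (+-suc a b))
        arith′ : ∀ d′ a b n → suc d′ + (a + b) + n ≡ a + (suc d′ + n + b)
        arith′ = solve-∀
        len : suc d′ + m + n ≡ a + (suc d′ + n + b)
        len = trans (cong (λ l → suc d′ + l + n) m≡) (arith′ d′ a b n)
      -- a crossing reflected onto itself would be a palindrome, hence a loop
      centre : ∀ a → a + suc a ≡ suc m → ¬ Arrival (suc (p + d′ + a))
      centre a e ar with occ⁻ ar | act-window (p + a) (p + a) (suc d′) n 0 (suc d′) (mirror a a e) refl
      ... | r | inj₁ (mo , _) = contradict mo anti
        where
        contradict : ∀ {η} → IsMorph η → IsAnti η → ⊥
        contradict morph-I ()
        contradict morph-RS ()
      ... | r | inj₂ (_ , e′) with ends-~ r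
      ...   | inj₁ (f , l) = noLoop (~-trans f (~-trans (Θ , trans (cong (act Θ) (sym at-0)) e′) (~-sym l)))
      ...   | inj₂ (f , l) = noLoop (~-trans f (~-trans (~-sym (Θ , trans (cong (act Θ) (sym at-0)) e′)) (~-sym l)))
      even : parity h (suc m) ≡ false
      even = parity-symmetric h (suc m)
        (λ a b e → does-⇔
          (mk⇔ (λ ar → occ⁺ (~-trans (occ⁻ ar) (Θ , mirror a b e)))
               (λ ar → occ⁺ (~-trans (occ⁻ ar) (~-sym (Θ , mirror a b e)))))
          (arrival? _) (arrival? _))
        (λ a e → dec-false (arrival? _) (centre a e))

    -- Intermediate visits of the class cut the stretch into return words; `side` thereby becomes a
    -- function of the vertex.
    side-class : ∀ g p → Special z (F p n) → F p n ~ F (p + g) n → side (p + g) ≡ side p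
    side-class = <-rec _ step
      where
      step : ∀ g → (∀ {g′} → g′ < g → ∀ p → Special z (F p n) → F p n ~ F (p + g′) n → side (p + g′) ≡ side p) →
             ∀ p → Special z (F p n) → F p n ~ F (p + g) n → side (p + g) ≡ side p
      step zero rec p sp r = cong side (+-identityʳ p)
      step g@(suc _) rec p sp r with anyUpTo? (λ k → 1 ≤? k ×-dec (F p n ~? F (p + k) n)) g
      ... | no none = side-return p g sp (s≤s z≤n) (r , λ k 0<k k<g r′ → none (k , k<g , 0<k , r′))
      ... | yes (k , k<g , 0<k , r′) with m≤n⇒∃[o]m+o≡n (<⇒≤ k<g)
      ...   | o , eq = trans (cong side (sym p+g)) (trans
                (rec o<g (p + k) (special-~ sp r′) (~-trans (~-sym r′) (subst (λ q → F p n ~ F q n) (sym p+g) r)))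
                (rec k<g p sp r′))
        where
        p+g : p + k + o ≡ p + g
        p+g = trans (+-assoc p k o) (cong (p +_) eq)
        o<g : o < g
        o<g = ≤-trans (+-monoˡ-< o 0<k) (≤-reflexive eq)

    side-≡ : ∀ p q → Special z (F p n) → F p n ~ F q n → side p ≡ side q
    side-≡ p q sp r with ≤-total p q
    ... | inj₁ p≤q with m≤n⇒∃[o]m+o≡n p≤q
    ...   | g , refl = sym (side-class g p sp r)
    side-≡ p q sp r | inj₂ q≤p with m≤n⇒∃[o]m+o≡n q≤p
    ...   | g , refl = side-class g q (special-~ sp r) (~-sym r)

    -- A crossing arrives in a special window, so none arrives strictly inside an edge.
    side-edge : ∀ {p d₁} → Edge n p d₁ → side (p + d₁) ≡ does (arrival? (p + d₁)) xor side p
    side-edge {p} (edge (s≤s {n = d′} z≤n) sp sp′ int) = begin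
      side (p + suc d′)                                    ≡⟨ cong side (+-suc p d′) ⟩
      does (arrival? (suc (p + d′))) xor side (p + d′)
        ≡⟨ cong₂ (λ q s → does (arrival? q) xor s) (sym (+-suc p d′)) (side-const p d′ early) ⟩
      does (arrival? (p + suc d′)) xor side p ∎
      where
      open ≡-Reasoning
      early : ∀ j → j < d′ → ¬ Arrival (suc (p + j))
      early j j<d′ ar with arrival⁻ ar
      ... | a , eq , r = int (suc j) (s≤s z≤n) (s≤s j<d′)
              (subst (λ q → Special z (F q n)) (trans eq (sym (+-suc p j))) (Edge.last (occ-edge r)))

    -- The crossing starts in a special window, which lies neither before p, by `start-≥`, nor
    -- inside the edge; so the two coincide.
    arrival-edge : ∀ {p d₁} → Edge n p d₁ → Arrival (p + d₁) → E ~ F p (d₁ + n)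
    arrival-edge {p} {d₁} (edge 0<d₁ sp sp′ int) ar with arrival⁻ ar
    ... | a , eq , r with m≤n⇒∃[o]m+o≡n (start-≥ sp r (≤-trans (≤-reflexive (cong suc (sym (+-identityʳ p)))) (≤-trans (+-monoʳ-< p 0<d₁) (≤-reflexive (sym eq)))))
    ...   | zero , refl = subst₂ (λ q l → E ~ F q (l + n)) (+-identityʳ p)
              (+-cancelˡ-≡ p d d₁ (trans (cong (_+ d) (sym (+-identityʳ p))) eq)) r
    ...   | suc k , refl = ⊥-elim (int (suc k) (s≤s z≤n)
              (+-cancelˡ-< p (suc k) d₁ (≤-trans (≤-trans (≤-reflexive (+-comm 1 (p + suc k))) (+-monoʳ-≤ (p + suc k) 0<d)) (≤-reflexive eq)))
              (Edge.first (occ-edge r)))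

    side-other : ∀ {p d₁} → Edge n p d₁ → ¬ E ~ F p (d₁ + n) → side (p + d₁) ≡ side p
    side-other {p} e ≁ = trans (side-edge e) (cong (_xor side p) (dec-false (arrival? _) (≁ ∘ arrival-edge e)))

    side-E : side (p₀ + d) ≡ not (side p₀)
    side-E = trans (side-edge ed) (cong (_xor side p₀) (dec-true (arrival? _) (arrival⁺ p₀ ~-refl)))

    side-walk : ∀ {v w es} → Walk z n v w es → All (λ e → ¬ E ~ e) es → Special z v →
                ∀ p q → v ~ F p n → w ~ F q n → side p ≡ side q
    side-walk (nil vw) _ sp p q vp wq =
      side-≡ p q (special-~ sp vp) (~-trans (~-sym vp) (~-trans vw wq))
    side-walk (fwd ie _ ve wk) (≁ ∷ al) sp p q vp wq with isEdge⇒edge ie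
    ... | p₁ , d₁ , refl , e₁ = trans
            (side-≡ p p₁ (special-~ sp vp) (~-trans (~-sym vp) (subst (_ ~_) (take-prefix-sub n p₁ d₁) ve)))
            (trans (sym (side-other e₁ ≁))
              (side-walk wk al (proj₁ (proj₂ (proj₂ (proj₂ ie)))) (p₁ + d₁) q (I , suffix-sub n p₁ d₁) wq))
    side-walk (bwd ie _ ve wk) (≁ ∷ al) sp p q vp wq with isEdge⇒edge ie
    ... | p₁ , d₁ , refl , e₁ = trans
            (side-≡ p (p₁ + d₁) (special-~ sp vp) (~-trans (~-sym vp) (subst (_ ~_) (suffix-sub n p₁ d₁) ve)))
            (trans (side-other e₁ ≁)
              (side-walk wk al (proj₁ (proj₂ (proj₂ ie))) p₁ q (I , take-prefix-sub n p₁ d₁) wq))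

  -- The rest of a closed walk joins the two ends of its first edge while avoiding the class of that
  -- edge, so both ends would be on one side, against `side-E`.
  acyclic : ∀ n → 1 ≤ n → Acyclic z n
  acyclic n 1≤n v [] _ _ = refl
  acyclic n 1≤n v (e ∷ es) (fwd ie nl ve wk) (al ∷ _) with isEdge⇒edge ie
  ... | p , d , refl , ed = ⊥-elim (not-¬ refl (trans (sym
          (side-walk wk al (proj₁ (proj₂ (proj₂ (proj₂ ie)))) (p + d) p (I , suffix-sub n p d)
            (subst (v ~_) (take-prefix-sub n p d) ve))) side-E))
    where
    open Crossings n 1≤n p d ed (nl ∘ subst₂ _~_ (sym (take-prefix-sub n p d)) (sym (suffix-sub n p d)))
  acyclic n 1≤n v (e ∷ es) (bwd ie nl ve wk) (al ∷ _) with isEdge⇒edge ie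
  ... | p , d , refl , ed = ⊥-elim (not-¬ refl (trans
          (side-walk wk al (proj₁ (proj₂ (proj₂ ie))) p (p + d) (I , take-prefix-sub n p d)
            (subst (v ~_) (suffix-sub n p d) ve)) side-E))
    where
    open Crossings n 1≤n p d ed (nl ∘ subst₂ _~_ (sym (take-prefix-sub n p d)) (sym (suffix-sub n p d)))

-- Closure and recurrence of the language

transfer : ∀ {u p q} w o n → At u p w → At u q w → o + n ≤ length w → At u (q + o) (sub u (p + o) n)
transfer {u} {p} {q} w o n hp hq le with m≤n⇒∃[o]m+o≡n le
... | d , eq = At-++⁻ˡ (sub u (p + o) n) (At-cast (cong (q +_) (sub-length u p o))
        (At-++⁻ʳ (sub u p o) (subst (At u q) w≡ hq)))
  where
  w≡ : w ≡ sub u p o ++ sub u (p + o) n ++ sub u (p + o + n) d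
  w≡ = trans (sym (At⇒sub≡ hp)) (trans (cong (sub u p) (trans (sym eq) (+-assoc o n d)))
         (trans (sub-++ u p o (n + d)) (cong (sub u p o ++_) (sub-++ u (p + o) n d))))

∃Letter? : {P : Letter → Set} → (∀ a → Dec (P a)) → Dec (∃ P)
∃Letter? {P} P? = map′ to from (P? c0 ⊎-dec P? c1 ⊎-dec P? c2)
  where
  to : P c0 ⊎ P c1 ⊎ P c2 → ∃ P
  to (inj₁ p)        = c0 , p
  to (inj₂ (inj₁ p)) = c1 , p
  to (inj₂ (inj₂ p)) = c2 , p
  from : ∃ P → P c0 ⊎ P c1 ⊎ P c2
  from (c0 , p) = inj₁ p
  from (c1 , p) = inj₂ (inj₁ p)
  from (c2 , p) = inj₂ (inj₂ p)

module Language (x y z : Seq)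
                (hx : ∀ n → IsPrefixOf (iter n fW (c0 ∷ [])) x)
                (hy : ∀ n → IsPrefixOf (morph gL (pre x n)) y)
                (hz : ∀ n → IsPrefixOf (tauW 0 (pre y n)) z) where

  module X = Fixed x hx
  module Z = Coded x y z hx hy hz
  open Returns z using (F; act-sub-morph; act-sub-anti)

  -- The images 01, 022, 02 contain no, two and one letters 2, so f preserves their parity.
  sgn-image : ∀ k → sgn x (X.b k) ≡ sgn x k
  sgn-image zero    = refl
  sgn-image (suc k) = trans (X.σ-+ (X.b k) (fL (x k)) (At-++⁻ˡ (fL (x k)) (X.f-spec k)))
    (trans (nxs-fL (x k) (sgn x (X.b k))) (cong (nx (x k)) (sgn-image k)))
    where
    nxs-fL : ∀ a τ → nxs (fL a) τ ≡ nx a τ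
    nxs-fL c0 τ = refl
    nxs-fL c1 τ = not-involutive τ
    nxs-fL c2 τ = refl

  fimg : Word → Word
  fimg = X.img fM true

  fimg-At : ∀ {k} s → At x k s → At x (X.b k) (fimg s)
  fimg-At {k} s h = subst (At x (X.b k)) (X.img-const fM (λ _ _ → refl) s (sgn x k) true) (X.at-imgM k s h)

  fimg-length : ∀ {k} s → At x k s → X.b k + length (fimg s) ≡ X.b (k + length s) + 1
  fimg-length {k} s h = X.img-length fM 1 (λ _ → refl) true k s h

  zimg-length : ∀ {k} τ s → At x k s → Z.b k + length (Z.img zM τ s) ≡ Z.b (k + length s) + 18
  zimg-length {k} τ s h = Z.img-length zM 18 (BlockCode.M-len zCode) τ k s h

  fimg-longer : ∀ s → At x 0 s → suc (length s) ≤ length (fimg s)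
  fimg-longer s h = ≤-trans (s≤s (X.n≤b (length s)))
    (≤-reflexive (sym (trans (fimg-length s h) (+-comm (X.b (length s)) 1))))

  -- Applying f lengthens a repeated prefix and keeps its sign; the start is position 4, after 0102.
  -- In z the repetition becomes a prefix with 1 and 2 exchanged, whence closure under RS.
  negative-prefix : ∀ N → ∃[ k ] sgn x k ≡ false × At x k (sub x 0 N)
  negative-prefix zero    = 4 , sgn4 , []
    where
    sgn4 : sgn x 4 ≡ false
    sgn4 rewrite X.x-nth 0 (toWitness {a? = 1 ≤? length X.X} _) | X.x-nth 1 (toWitness {a? = 2 ≤? length X.X} _)
               | X.x-nth 2 (toWitness {a? = 3 ≤? length X.X} _) | X.x-nth 3 (toWitness {a? = 4 ≤? length X.X} _) = refl
  negative-prefix (suc N) with negative-prefix N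
  ... | k , sg , h = X.b k , trans (sgn-image k) sg ,
        At-cast (+-identityʳ (X.b k)) (transfer (fimg s) 0 (suc N) (fimg-At s (At-sub 0 N)) (fimg-At s h)
          (≤-trans (≤-reflexive (cong suc (sym (sub-length x 0 N)))) (fimg-longer s (At-sub 0 N))))
    where s = sub x 0 N

  palindromic-prefix : ∀ N → ∃[ s ] At x 0 s × reverse s ≡ s × N ≤ length s
  palindromic-prefix zero    = [] , [] , refl , z≤n
  palindromic-prefix (suc N) with palindromic-prefix N
  ... | s , h , ps , N≤ = fimg s , fimg-At s h ,
        trans (X.img-reverse true s) (trans (cong (X.img fM (nxs s true)) ps) (X.img-const fM (λ _ _ → refl) s _ _)) ,
        ≤-trans (s≤s N≤) (fimg-longer s h)

  prefix-image : ∀ η V q w → At z 0 V → At z q (act η V) → ∀ i → F i (length w) ≡ w → i + length w ≤ length V →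
                 Factor z (act η w)
  prefix-image η V q w h0 hq i refl′ le with m≤n⇒∃[o]m+o≡n le
  ... | d , eq = [ (λ mo → toFactor (q + i) (act-sub-morph mo 0 q i (length w) d e)) ,
                   (λ an → toFactor (q + d) (act-sub-anti an 0 q i (length w) d e)) ]′ (morph⊎anti η)
    where
    L≡ : length V ≡ i + (length w + d)
    L≡ = trans (sym eq) (+-assoc i (length w) d)
    e : act η (F 0 (i + (length w + d))) ≡ F q (i + (length w + d))
    e = trans (cong (act η) (trans (cong (F 0) (sym L≡)) (At⇒sub≡ h0)))
          (trans (sym (At⇒sub≡ hq)) (cong (F q) (trans (act-length η V) L≡)))
    toFactor : ∀ p → act η (F i (length w)) ≡ F p (length w) → Factor z (act η w)
    toFactor p e′ = p , trans (factorAt≡sub z p _) (trans (cong (F p) (act-length η w))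
                          (trans (sym e′) (cong (act η) refl′)))

  zimg-longer : ∀ τ s → At x 0 s → length s ≤ length (Z.img zM τ s)
  zimg-longer τ s h = ≤-trans (≤-trans (Z.n≤b (length s)) (m≤m+n (Z.b (length s)) 18))
                        (≤-reflexive (sym (zimg-length τ s h)))

  closed-RS : ∀ {w} → Factor z w → Factor z (act RS w)
  closed-RS {w} (i , e) with negative-prefix (i + length w)
  ... | k , sg , h = prefix-image RS (Z.img zM true s) (Z.b k) w (Z.at-imgM 0 s (At-sub 0 _))
        (subst (At z (Z.b k)) (trans (cong (λ τ → Z.img zM τ s) sg) (sym (Z.swap-img zM Z.swap-M s true))) (Z.at-imgM k s h))
        i (trans (sym (factorAt≡sub z i (length w))) e)
        (≤-trans (≤-reflexive (sym (sub-length x 0 (i + length w)))) (zimg-longer true s (At-sub 0 _)))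
    where s = sub x 0 (i + length w)

  -- The image of a palindromic prefix of x is fixed by R or by S, depending on its final sign.
  -- Which of the two is left open; closure under RS then supplies the other.
  closed-R⊎S : ∀ {w} → Factor z w → Factor z (act R w) ⊎ Factor z (act S w)
  closed-R⊎S {w} (i , e) with palindromic-prefix (i + length w)
  ... | s , h , ps , N≤ = go (nxs s true) refl
    where
    V = Z.img zM true s
    at : At z 0 V
    at = Z.at-imgM 0 s h
    rev : reverse V ≡ Z.img zM (nxs s true) s
    rev = trans (Z.img-reverse true s) (cong (Z.img zM (nxs s true)) ps)
    w≡ = trans (sym (factorAt≡sub z i (length w))) e
    le = ≤-trans N≤ (zimg-longer true s h)
    go : ∀ τ → nxs s true ≡ τ → Factor z (act R w) ⊎ Factor z (act S w)
    go true  e = inj₁ (prefix-image R V 0 w at (subst (At z 0) (sym (trans rev (cong (λ τ → Z.img zM τ s) e))) at) i w≡ le)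
    go false e = inj₂ (prefix-image S V 0 w at (subst (At z 0) (sym S-fixed) at) i w≡ le)
      where
      S-fixed : act S V ≡ V
      S-fixed = trans (sym (reverse-map swapL V)) (trans (cong (map swapL) (trans rev
        (trans (cong (λ τ → Z.img zM τ s) e) (sym (Z.swap-img zM Z.swap-M s true))))) (map-swap-involutive V))

  closed : Closed z
  closed I  w f = f
  closed RS w f = closed-RS f
  closed R  w f = [ id , (λ g → subst (Factor z) (act-∙ RS S w) (closed-RS g)) ]′ (closed-R⊎S f)
  closed S  w f = [ (λ g → subst (Factor z) (reverse-map swapL w) (closed-RS g)) , id ]′ (closed-R⊎S f)

  early : ∀ a τ → ∃[ i ] i < 22 × nth X.X i ≡ a × nxs (take i X.X) true ≡ τ
  early = from-yes (∀Letter? λ a → ∀Bool? λ τ →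
    anyUpTo? (λ i → (nth X.X i ≟L a) ×-dec (nxs (take i X.X) true Bool.≟ τ)) 22)

  -- The sign has to recur as well, because the image in z depends on it.
  Recurs : ℕ → ℕ → Set
  Recurs n B = ∀ i → ∃[ j ] j ≤ B × sgn x j ≡ sgn x i × At x j (sub x i n)

  b-growth : ∀ {len} m → (∀ a → m ≤ len a) → ∀ k c → pos len x k + c * m ≤ pos len x (c + k)
  b-growth m h k zero    = ≤-reflexive (+-identityʳ _)
  b-growth {len} m h k (suc c) = ≤-trans (≤-reflexive (arith (pos len x k) m (c * m)))
    (+-mono-≤ (b-growth m h k c) (h (x (c + k))))
    where
    arith : ∀ p m cm → p + (m + cm) ≡ p + cm + m
    arith = solve-∀

  recurrent₁ : Recurs 1 21
  recurrent₁ i with early (x i) (sgn x i)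
  ... | j , j<22 , xj , sj = j , ≤-pred j<22 , trans (sym sgn-j) sj , trans (X.x-nth j j<) xj ∷ []
    where
    j< : j < length X.X
    j< = ≤-trans j<22 (toWitness {a? = 22 ≤? length X.X} _)
    len : length (take j X.X) ≡ j
    len = trans (length-take j X.X) (m≤n⇒m⊓n≡m (<⇒≤ j<))
    sgn-j : nxs (take j X.X) true ≡ sgn x j
    sgn-j = trans (sym (X.σ-+ 0 (take j X.X) (At-++⁻ˡ (take j X.X) (subst (At x 0) (sym (take++drop≡id j X.X)) X.x-start))))
                  (cong (sgn x) len)

  recurrent : ∀ n → ∃ (Recurs n)
  recurrent = <-rec _ step
    where
    step : ∀ n → (∀ {m} → m < n → ∃ (Recurs m)) → ∃ (Recurs n)
    step 0 _ = 21 , λ i → let j , j≤ , sg , _ = recurrent₁ i in j , j≤ , sg , []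
    step 1 _ = 21 , recurrent₁
    -- The first block contributes at least one letter from the offset on, the next `c` blocks at
    -- least two each, hence n′ together, and the closing marker one more: n in total.
    step n@(suc (suc n′)) rec with rec {suc ⌈ n′ /2⌉} (s≤s (s≤s (⌈n/2⌉≤n n′)))
    ... | B , h = X.b B + 2 , found
      where
      c = ⌈ n′ /2⌉
      n′≤ : n′ ≤ c * 2
      n′≤ = ≤-trans (≤-reflexive (sym (⌊n/2⌋+⌈n/2⌉≡n n′))) (≤-trans (+-monoˡ-≤ c (⌊n/2⌋≤⌈n/2⌉ n′))
              (≤-reflexive (trans (cong (c +_) (sym (+-identityʳ c))) (*-comm 2 c))))
      found : ∀ i → ∃[ j ] j ≤ X.b B + 2 × sgn x j ≡ sgn x i × At x j (sub x i n)
      found i with X.locate i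
      ... | k , o , refl , o< with h k
      ...   | j , j≤ , sg , hj = X.b j + o , +-mono-≤ (X.b-mono j≤) (≤-pred (≤-trans o< (lenF≤3 (x k)))) ,
              trans (sgn-at j (fimg-At s hj)) (trans (cong (nxs (take o w)) (trans (sgn-image j) (trans sg (sym (sgn-image k)))))
                (sym (sgn-at k (fimg-At s hk)))) ,
              transfer w o n (fimg-At s hk) (fimg-At s hj) enough
        where
        s = sub x k (suc c)
        hk = At-sub k (suc c)
        w = fimg s
        lenF≤3 : ∀ a → lenF a ≤ 3
        lenF≤3 = from-yes (∀Letter? λ a → lenF a ≤? 3)
        enough : o + n ≤ length w
        enough = +-cancelˡ-≤ (X.b k) _ _ (begin
          X.b k + (o + (2 + n′))           ≡⟨ arith₁ (X.b k) o n′ ⟩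
          X.b k + suc o + n′ + 1           ≤⟨ +-monoˡ-≤ 1 (+-mono-≤ (+-monoʳ-≤ (X.b k) o<) n′≤) ⟩
          X.b (suc k) + c * 2 + 1          ≤⟨ +-monoˡ-≤ 1 (b-growth 2 (from-yes (∀Letter? λ a → 2 ≤? lenF a)) (suc k) c) ⟩
          X.b (c + suc k) + 1              ≡⟨ cong (λ l → X.b l + 1) (trans (+-suc c k) (trans (cong suc (+-comm c k)) (sym (+-suc k c)))) ⟩
          X.b (k + suc c) + 1              ≡⟨ cong (λ l → X.b (k + l) + 1) (sym (sub-length x k (suc c))) ⟩
          X.b (k + length s) + 1           ≡⟨ sym (fimg-length s hk) ⟩
          X.b k + length w ∎)
          where
          open ≤-Reasoning
          arith₁ : ∀ b o n → b + (o + (2 + n)) ≡ b + suc o + n + 1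
          arith₁ = solve-∀
        len-o : length (take o w) ≡ o
        len-o = trans (length-take o w) (m≤n⇒m⊓n≡m (≤-trans (m≤m+n o n) enough))
        sgn-at : ∀ l → At x (X.b l) w → sgn x (X.b l + o) ≡ nxs (take o w) (sgn x (X.b l))
        sgn-at l g = trans (cong (λ d → sgn x (X.b l + d)) (sym len-o))
          (X.σ-+ (X.b l) (take o w) (At-++⁻ˡ (take o w) (subst (At x (X.b l)) (sym (take++drop≡id o w)) g)))

  z-recurrent : ∀ n → ∃[ B ] (∀ i → ∃[ j ] j ≤ B × At z j (F i n))
  z-recurrent n with recurrent (suc n)
  ... | B , h = Z.b B + 24 , found
    where
    found : ∀ i → ∃[ j ] j ≤ Z.b B + 24 × At z j (F i n)
    found i with Z.locate i
    ... | k , o , refl , o< with h k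
    ...   | j , j≤ , sg , hj = Z.b j + o , +-mono-≤ (Z.b-mono j≤) (≤-trans (<⇒≤ o<) (lenZ≤24 (x k))) ,
            transfer w o n (Z.at-imgM k s hk) (subst (λ τ → At z (Z.b j) (Z.img zM τ s)) sg (Z.at-imgM j s hj)) enough
      where
      s = sub x k (suc n)
      hk = At-sub k (suc n)
      w = Z.img zM (sgn x k) s
      lenZ≤24 : ∀ a → lenZ a ≤ 24
      lenZ≤24 = from-yes (∀Letter? λ a → lenZ a ≤? 24)
      enough : o + n ≤ length w
      enough = +-cancelˡ-≤ (Z.b k) _ _ (begin
        Z.b k + (o + n)                  ≡⟨ sym (+-assoc (Z.b k) o n) ⟩
        Z.b k + o + n                    ≤⟨ +-mono-≤ (+-monoʳ-≤ (Z.b k) (<⇒≤ o<)) (≤-reflexive (sym (*-identityʳ n))) ⟩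
        Z.b (suc k) + n * 1              ≤⟨ b-growth 1 (from-yes (∀Letter? λ a → 1 ≤? lenZ a)) (suc k) n ⟩
        Z.b (n + suc k)                  ≡⟨ cong Z.b (trans (+-suc n k) (trans (cong suc (+-comm n k)) (sym (+-suc k n)))) ⟩
        Z.b (k + suc n)                  ≡⟨ cong (λ l → Z.b (k + l)) (sym (sub-length x k (suc n))) ⟩
        Z.b (k + length s)               ≤⟨ m≤m+n _ 18 ⟩
        Z.b (k + length s) + 18          ≡⟨ sym (zimg-length (sgn x k) s hk) ⟩
        Z.b k + length w ∎)
        where open ≤-Reasoning

  factor? : ∀ w → Dec (Factor z w)
  factor? w with z-recurrent (length w)
  ... | B , h = map′ (λ (i , _ , e) → i , e) from (anyUpTo? (λ i → factorAt z i (length w) ≟W w) (suc B))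
    where
    from : Factor z w → ∃[ i ] i < suc B × factorAt z i (length w) ≡ w
    from (i , e) with h i
    ... | j , j≤ , hj = j , s≤s j≤ , trans (factorAt≡sub z j (length w))
            (trans (cong (F j) (sym (sub-length z i (length w)))) (trans (At⇒sub≡ hj)
              (trans (sym (factorAt≡sub z i (length w))) e)))

  special? : ∀ w → Dec (Special z w)
  special? w =
    (∃Letter? λ a → ∃Letter? λ b → ¬? (a ≟L b) ×-dec factor? (a ∷ w) ×-dec factor? (b ∷ w)) ⊎-dec
    (∃Letter? λ a → ∃Letter? λ b → ¬? (a ≟L b) ×-dec factor? (w ++ a ∷ []) ×-dec factor? (w ++ b ∷ []))

-- Connectedness of the graph, and the theorem

module Connectivity (z : Seq) (closed : Closed z) (special? : ∀ w → Dec (Special z w))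
                    (return-fixed : ∀ n → 1 ≤ n → ∀ p d → 0 < d → Returns.Return z n p d → Returns.Fixed z p (d + n))
                    where

  open Returns z using (F)
  open Graph z closed return-fixed

  walk-~ : ∀ {n v v′ w es} → v ~ v′ → Walk z n v′ w es → Walk z n v w es
  walk-~ r (nil r′)          = nil (~-trans r r′)
  walk-~ r (fwd ie nl r′ wk) = fwd ie nl (~-trans r r′) wk
  walk-~ r (bwd ie nl r′ wk) = bwd ie nl (~-trans r r′) wk

  walk-++ : ∀ {n u v w es es′} → Walk z n u v es → Walk z n v w es′ → Walk z n u w (es ++ es′)
  walk-++ (nil r)          wk′ = walk-~ r wk′
  walk-++ (fwd ie nl r wk) wk′ = fwd ie nl r (walk-++ wk wk′)
  walk-++ (bwd ie nl r wk) wk′ = bwd ie nl r (walk-++ wk wk′)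

  Joined : ℕ → Word → Word → Set
  Joined n v w = ∃ (Walk z n v w) × ∃ (Walk z n w v)

  -- The stretch is cut at the special windows that `special?` finds inside it. Uncut pieces are
  -- edges, and loops contribute the empty walk. Both directions are built together, in place of
  -- reversing walks.
  joined : ∀ n g p → Special z (F p n) → Special z (F (p + g) n) → Joined n (F p n) (F (p + g) n)
  joined n = <-rec _ step
    where
    step : ∀ g → (∀ {h} → h < g → ∀ p → Special z (F p n) → Special z (F (p + h) n) → Joined n (F p n) (F (p + h) n)) →
           ∀ p → Special z (F p n) → Special z (F (p + g) n) → Joined n (F p n) (F (p + g) n)
    step zero rec p s s′ = ([] , nil (I , sym at-0)) , ([] , nil (I , at-0))
    step g@(suc _) rec p s s′ with anyUpTo? (λ k → 1 ≤? k ×-dec special? (F (p + k) n)) g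
    ... | yes (k , k<g , 0<k , sk) with m≤n⇒∃[o]m+o≡n (<⇒≤ k<g)
    ...   | o , eq with rec k<g p s sk |
                        subst (λ q → Joined n (F (p + k) n) (F q n)) p+g
                          (rec (≤-trans (+-monoˡ-< o 0<k) (≤-reflexive eq)) (p + k) sk
                            (subst (λ q → Special z (F q n)) (sym p+g) s′))
      where
      p+g : p + k + o ≡ p + g
      p+g = trans (+-assoc p k o) (cong (p +_) eq)
    ...     | (_ , w₁) , (_ , w₂) | (_ , w₃) , (_ , w₄) = (_ , walk-++ w₁ w₃) , (_ , walk-++ w₄ w₂)
    step g@(suc _) rec p s s′ | no none with F p n ~? F (p + g) n
    ... | yes r = ([] , nil r) , ([] , nil (~-sym r))
    ... | no ≁  = (_ , fwd ie noLoop (I , sym (take-prefix-sub n p g)) (nil (I , suffix-sub n p g))) ,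
                  (_ , bwd ie noLoop (I , sym (suffix-sub n p g)) (nil (I , take-prefix-sub n p g)))
      where
      ie : IsEdge z n (F p (g + n))
      ie = edge⇒isEdge (edge (s≤s z≤n) s s′ (λ k 0<k k<g sk → none (k , k<g , 0<k , sk)))
      noLoop : ¬ Loop n (F p (g + n))
      noLoop = ≁ ∘ subst₂ _~_ (take-prefix-sub n p g) (suffix-sub n p g)

  factor-At : ∀ {w} (f : Factor z w) → At z (proj₁ f) w
  factor-At f = subst (At z (proj₁ f)) (factor⇒sub f) (At-sub (proj₁ f) _)

  special-position : ∀ {w} → Special z w → ∃[ p ] F p (length w) ≡ w
  special-position {w} (inj₁ (_ , _ , _ , f , _)) with factor-At f
  ... | _ ∷ h = suc (proj₁ f) , At⇒sub≡ h
  special-position {w} (inj₂ (_ , _ , _ , f , _)) = proj₁ f , At⇒sub≡ (At-++⁻ˡ w (factor-At f))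

  connected : ∀ n → Connected z n
  connected n v w lv lw sv sw with special-position sv | special-position sw
  ... | p , ev | q , ew = subst₂ (λ v w → ∃ (Walk z n v w)) ev′ ew′
          (walk (subst (Special z) (sym ev′) sv) (subst (Special z) (sym ew′) sw))
    where
    ev′ : F p n ≡ v
    ev′ = trans (cong (F p) (sym lv)) ev
    ew′ : F q n ≡ w
    ew′ = trans (cong (F q) (sym lw)) ew
    walk : Special z (F p n) → Special z (F q n) → ∃ (Walk z n (F p n) (F q n))
    walk s s′ with ≤-total p q
    ... | inj₁ p≤q with m≤n⇒∃[o]m+o≡n p≤q
    ...   | g , refl = proj₁ (joined n g p s s′)
    walk s s′ | inj₂ q≤p with m≤n⇒∃[o]m+o≡n q≤p
    ...   | g , refl = proj₂ (joined n g q s′ s)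

theorem13 : (x y z : Seq) →
    (∀ n → IsPrefixOf (iter n fW (c0 ∷ [])) x) →
    (∀ n → IsPrefixOf (morph gL (pre x n)) y) →
    (∀ n → IsPrefixOf (tauW 0 (pre y n)) z) →
    GRich z
theorem13 x y z hx hy hz =
  closed , λ n 1≤n → (Connectivity.connected z closed special? return-fixed n , acyclic n 1≤n) , loopsPal n 1≤n
  where
  open Language x y z hx hy hz
  return-fixed : ∀ n → 1 ≤ n → ∀ p d → 0 < d → Returns.Return z n p d → Returns.Fixed z p (d + n)
  return-fixed = Returns.WithPals.return-fixed z Z.palSuffixes
  open Graph z closed return-fixed
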